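{- Let $R$ be an integral domain, $f \in R[X]$ a monic polynomial, and $f = \prod_{i=1}^n f_i$ a factorisation of $f$ into monic polynomials $f_i \in R[X]$. Let $\Psi_f : R[X]/(f) \to \bigoplus_{i=1}^n R[X]/(f_i)$ be the natural map $h \bmod f \mapsto \bigoplus_i h \bmod f_i$. Then the determinant of $\Psi_f$ written with respect to the standard bases is \[\det(\Psi_f) = \prod_{1 \le i < j \le n}\mathcal{R}(f_j, f_i).\]
   Context: The standard basis of $R[X]/(g)$ for monic $g$ of degree $d$ is $(1, \overline{X}, \dots, \overline{X}^{d-1})$; the summands of $\bigoplus_{i=1}^n R[X]/(f_i)$ are taken in the order $i = 1, \dots, n$. For monic polynomials $g,h$, the resultant is $\mathcal{R}(g,h) = \prod_{\alpha}\prod_{\beta}(\alpha-\beta)$, the product over the roots $\alpha$ of $g$ and $\beta$ of $h$ (with multiplicity) in an algebraic closure of the fraction field of $R$; it lies in $R$. -}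

module Defs where

open import Algebra.Bundles using (CommutativeRing; CommutativeMonoid)
open import Algebra.Definitions.RawMagma using (_,_)
open import Algebra.Module.Bundles using (Module)
open import Algebra.Module.Morphism.Structures using (module ModuleMorphisms)
open import Algebra.Module.Structures.Biased using (IsModuleFromLeft)
import Algebra.Morphism.Construct.Composition as Composition
open import Algebra.Morphism.Structures using (IsRingHomomorphism; IsRingMonomorphism)
open import Data.Bool.Base using (if_then_else_)
open import Data.Empty using (⊥-elim)
open import Data.Fin.Base using (Fin; zero; suc; toℕ; fromℕ; fromℕ<; inject₁; splitAt; _↑ˡ_; _↑ʳ_; punchIn)
open import Data.Fin.Properties using (toℕ<n; toℕ-fromℕ; toℕ-inject₁; toℕ-fromℕ<; splitAt-↑ˡ; splitAt-↑ʳ; splitAt⁻¹-↑ˡ; splitAt⁻¹-↑ʳ; _<?_)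
open import Data.List.Base as List using (List; []; _∷_; tabulate)
open import Data.Nat.Base as ℕ using (ℕ; zero; suc; z≤n; s≤s; z<s; s<s)
open import Data.Nat.Properties as ℕₚ using ()
open import Data.Product.Base using (Σ; ∃-syntax; _×_; _,_; proj₁; proj₂)
open import Data.Sum.Base using (_⊎_; inj₁; inj₂; [_,_])
open import Data.Vec.Functional as Vector using (Vector; _++_)
open import Function.Base using (_∘_)
open import Level using (Level; _⊔_) renaming (suc to lsuc)
open import Relation.Binary.Definitions using (Tri; tri<; tri≈; tri>)
open import Relation.Binary.PropositionalEquality.Core as ≡ using (_≡_)
open import Relation.Nullary.Decidable using (does)
open import Relation.Nullary.Negation using (¬_)
import Algebra.Definitions.RawMonoid as RawMonoidDefs
import Algebra.Properties.AbelianGroup as AbelianGroupProperties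
import Algebra.Properties.CommutativeMonoid.Sum as MonoidSum
import Algebra.Properties.CommutativeSemigroup as CommutativeSemigroupProperties
import Algebra.Properties.Ring as RingProperties
import Algebra.Properties.Semiring.Exp as Exp
import Relation.Binary.Reasoning.Setoid as SetoidReasoning

private variable
  c ℓ c₁ ℓ₁ c₂ ℓ₂ m ℓm : Level

module FiniteSums (R : CommutativeRing c ℓ) where
  open CommutativeRing R

  ∑ : ∀ {n} → Vector Carrier n → Carrier
  ∑ = RawMonoidDefs.sum +-rawMonoid

  ∏ : ∀ {n} → Vector Carrier n → Carrier
  ∏ = RawMonoidDefs.sum *-rawMonoid

  ∏-i<j : ∀ {n} → (Fin n → Fin n → Carrier) → Carrier
  ∏-i<j a = ∏ λ i → ∏ λ j → if does (i <? j) then a i j else 1#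

totalℕ : ∀ {n} → Vector ℕ n → ℕ
totalℕ = Vector.foldr ℕ._+_ 0

module Polynomials (R : CommutativeRing c ℓ) where
  open CommutativeRing R hiding (zero)
  open RingProperties ring using (-0#≈0#; -‿distribʳ-*; -‿distribˡ-*; -‿involutive; -‿+-comm)
  private
    module ≈R = SetoidReasoning setoid
    module +R = CommutativeSemigroupProperties +-commutativeSemigroup

  -- Coefficient lists, constant term first.  Trailing zeros are allowed;
  -- equality compares coefficients.
  Poly : Set c
  Poly = List Carrier

  coeff : Poly → ℕ → Carrier
  coeff []      k       = 0#
  coeff (a ∷ p) zero    = a
  coeff (a ∷ p) (suc k) = coeff p k

  infix 4 _≈ₚ_
  record _≈ₚ_ (p q : Poly) : Set ℓ where
    constructor coeffwise
    field at : ∀ k → coeff p k ≈ coeff q k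
  open _≈ₚ_ public

  infixl 6 _+ₚ_
  infixl 7 _*ₚ_
  infixr 7 _·_
  infix 8 -ₚ_

  _+ₚ_ : Poly → Poly → Poly
  []      +ₚ q       = q
  (a ∷ p) +ₚ []      = a ∷ p
  (a ∷ p) +ₚ (b ∷ q) = (a + b) ∷ (p +ₚ q)

  -ₚ_ : Poly → Poly
  -ₚ_ = List.map (λ a → - a)

  _·_ : Carrier → Poly → Poly
  a · p = List.map (a *_) p

  _*ₚ_ : Poly → Poly → Poly
  []      *ₚ q = []
  (a ∷ p) *ₚ q = (a · q) +ₚ (0# ∷ (p *ₚ q))

  0ₚ 1ₚ : Poly
  0ₚ = []
  1ₚ = 1# ∷ []

  X^ : ℕ → Poly
  X^ zero    = 1ₚ
  X^ (suc k) = 0# ∷ X^ k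

  X-_ : Carrier → Poly
  X- α = - α ∷ 1# ∷ []

  eval : Poly → Carrier → Carrier
  eval []      x = 0#
  eval (a ∷ p) x = a + x * eval p x

  record Monic (p : Poly) : Set ℓ where
    field
      degree  : ℕ
      leading : coeff p degree ≈ 1#
      above   : ∀ k → degree ℕ.< k → coeff p k ≈ 0#

  ≈ₚ-refl : ∀ {p} → p ≈ₚ p
  ≈ₚ-refl .at k = refl

  ≈ₚ-sym : ∀ {p q} → p ≈ₚ q → q ≈ₚ p
  ≈ₚ-sym e .at k = sym (e .at k)

  ≈ₚ-trans : ∀ {p q r} → p ≈ₚ q → q ≈ₚ r → p ≈ₚ r
  ≈ₚ-trans e e′ .at k = trans (e .at k) (e′ .at k)

  coeff-+ : ∀ p q k → coeff (p +ₚ q) k ≈ coeff p k + coeff q k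
  coeff-+ []      q       k       = sym (+-identityˡ _)
  coeff-+ (a ∷ p) []      k       = sym (+-identityʳ _)
  coeff-+ (a ∷ p) (b ∷ q) zero    = refl
  coeff-+ (a ∷ p) (b ∷ q) (suc k) = coeff-+ p q k

  coeff-neg : ∀ p k → coeff (-ₚ p) k ≈ - coeff p k
  coeff-neg []      k       = sym -0#≈0#
  coeff-neg (a ∷ p) zero    = refl
  coeff-neg (a ∷ p) (suc k) = coeff-neg p k

  coeff-· : ∀ a p k → coeff (a · p) k ≈ a * coeff p k
  coeff-· a []      k       = sym (zeroʳ a)
  coeff-· a (b ∷ p) zero    = refl
  coeff-· a (b ∷ p) (suc k) = coeff-· a p k

  +ₚ-cong : ∀ {p p′ q q′} → p ≈ₚ p′ → q ≈ₚ q′ → p +ₚ q ≈ₚ p′ +ₚ q′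
  +ₚ-cong {p} {p′} {q} {q′} e e′ .at k =
    trans (coeff-+ p q k) (trans (+-cong (e .at k) (e′ .at k)) (sym (coeff-+ p′ q′ k)))

  -ₚ-cong : ∀ {p q} → p ≈ₚ q → -ₚ p ≈ₚ -ₚ q
  -ₚ-cong {p} {q} e .at k =
    trans (coeff-neg p k) (trans (-‿cong (e .at k)) (sym (coeff-neg q k)))

  ·-cong : ∀ {a b p q} → a ≈ b → p ≈ₚ q → a · p ≈ₚ b · q
  ·-cong {a} {b} {p} {q} e e′ .at k =
    trans (coeff-· a p k) (trans (*-cong e (e′ .at k)) (sym (coeff-· b q k)))

  ∷-cong : ∀ {a b p q} → a ≈ b → p ≈ₚ q → a ∷ p ≈ₚ b ∷ q
  ∷-cong e e′ .at zero    = e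
  ∷-cong e e′ .at (suc k) = e′ .at k

  +ₚ-assoc : ∀ p q r → (p +ₚ q) +ₚ r ≈ₚ p +ₚ (q +ₚ r)
  +ₚ-assoc p q r .at k = begin
    coeff ((p +ₚ q) +ₚ r) k             ≈⟨ coeff-+ (p +ₚ q) r k ⟩
    coeff (p +ₚ q) k + coeff r k        ≈⟨ +-congʳ (coeff-+ p q k) ⟩
    (coeff p k + coeff q k) + coeff r k ≈⟨ +-assoc _ _ _ ⟩
    coeff p k + (coeff q k + coeff r k) ≈⟨ +-congˡ (coeff-+ q r k) ⟨
    coeff p k + coeff (q +ₚ r) k        ≈⟨ coeff-+ p (q +ₚ r) k ⟨
    coeff (p +ₚ (q +ₚ r)) k             ∎
    where open ≈R

  +ₚ-comm : ∀ p q → p +ₚ q ≈ₚ q +ₚ p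
  +ₚ-comm p q .at k = trans (coeff-+ p q k) (trans (+-comm _ _) (sym (coeff-+ q p k)))

  +ₚ-identityʳ : ∀ p → p +ₚ 0ₚ ≈ₚ p
  +ₚ-identityʳ p = +ₚ-comm p 0ₚ

  -ₚ-inverseʳ : ∀ p → p +ₚ -ₚ p ≈ₚ 0ₚ
  -ₚ-inverseʳ p .at k =
    trans (coeff-+ p (-ₚ p) k) (trans (+-congˡ (coeff-neg p k)) (-‿inverseʳ _))

  -ₚ-inverseˡ : ∀ p → -ₚ p +ₚ p ≈ₚ 0ₚ
  -ₚ-inverseˡ p = ≈ₚ-trans (+ₚ-comm (-ₚ p) p) (-ₚ-inverseʳ p)

  ·-distribˡ : ∀ a p q → a · (p +ₚ q) ≈ₚ a · p +ₚ a · q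
  ·-distribˡ a p q .at k = begin
    coeff (a · (p +ₚ q)) k                ≈⟨ coeff-· a (p +ₚ q) k ⟩
    a * coeff (p +ₚ q) k                  ≈⟨ *-congˡ (coeff-+ p q k) ⟩
    a * (coeff p k + coeff q k)           ≈⟨ distribˡ a _ _ ⟩
    a * coeff p k + a * coeff q k         ≈⟨ +-cong (coeff-· a p k) (coeff-· a q k) ⟨
    coeff (a · p) k + coeff (a · q) k     ≈⟨ coeff-+ (a · p) (a · q) k ⟨
    coeff (a · p +ₚ a · q) k              ∎
    where open ≈R

  ·-distribʳ : ∀ p a b → (a + b) · p ≈ₚ a · p +ₚ b · p
  ·-distribʳ p a b .at k = begin
    coeff ((a + b) · p) k                 ≈⟨ coeff-· (a + b) p k ⟩
    (a + b) * coeff p k                   ≈⟨ distribʳ _ a b ⟩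
    a * coeff p k + b * coeff p k         ≈⟨ +-cong (coeff-· a p k) (coeff-· b p k) ⟨
    coeff (a · p) k + coeff (b · p) k     ≈⟨ coeff-+ (a · p) (b · p) k ⟨
    coeff (a · p +ₚ b · p) k              ∎
    where open ≈R

  ·-assoc : ∀ a b p → (a * b) · p ≈ₚ a · b · p
  ·-assoc a b p .at k = begin
    coeff ((a * b) · p) k  ≈⟨ coeff-· (a * b) p k ⟩
    (a * b) * coeff p k    ≈⟨ *-assoc a b _ ⟩
    a * (b * coeff p k)    ≈⟨ *-congˡ (coeff-· b p k) ⟨
    a * coeff (b · p) k    ≈⟨ coeff-· a (b · p) k ⟨
    coeff (a · b · p) k    ∎
    where open ≈R

  ·-identityˡ : ∀ p → 1# · p ≈ₚ p
  ·-identityˡ p .at k = trans (coeff-· 1# p k) (*-identityˡ _)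

  ·-zeroˡ : ∀ p → 0# · p ≈ₚ 0ₚ
  ·-zeroˡ p .at k = trans (coeff-· 0# p k) (zeroˡ _)

  0∷0 : 0# ∷ 0ₚ ≈ₚ 0ₚ
  0∷0 .at zero    = refl
  0∷0 .at (suc k) = refl

  0∷-distrib : ∀ p q → 0# ∷ (p +ₚ q) ≈ₚ (0# ∷ p) +ₚ (0# ∷ q)
  0∷-distrib p q = ∷-cong (sym (+-identityˡ 0#)) ≈ₚ-refl

  +ₚ-commutativeMonoid : CommutativeMonoid c ℓ
  +ₚ-commutativeMonoid = record
    { Carrier = Poly ; _≈_ = _≈ₚ_ ; _∙_ = _+ₚ_ ; ε = 0ₚ
    ; isCommutativeMonoid = record
      { isMonoid = record
        { isSemigroup = record
          { isMagma = record
            { isEquivalence = record { refl = ≈ₚ-refl ; sym = ≈ₚ-sym ; trans = ≈ₚ-trans }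
            ; ∙-cong = +ₚ-cong }
          ; assoc = +ₚ-assoc }
        ; identity = (λ _ → ≈ₚ-refl) , +ₚ-identityʳ }
      ; comm = +ₚ-comm } }

  private
    module ≈P = SetoidReasoning (CommutativeMonoid.setoid +ₚ-commutativeMonoid)
    module +P = CommutativeSemigroupProperties (CommutativeMonoid.commutativeSemigroup +ₚ-commutativeMonoid)

  *ₚ-congˡ : ∀ p {q r} → q ≈ₚ r → p *ₚ q ≈ₚ p *ₚ r
  *ₚ-congˡ []      e = ≈ₚ-refl
  *ₚ-congˡ (a ∷ p) e = +ₚ-cong (·-cong refl e) (∷-cong refl (*ₚ-congˡ p e))

  *ₚ-zeroʳ : ∀ p → p *ₚ 0ₚ ≈ₚ 0ₚ
  *ₚ-zeroʳ []      = ≈ₚ-refl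
  *ₚ-zeroʳ (a ∷ p) = ≈ₚ-trans (∷-cong refl (*ₚ-zeroʳ p)) 0∷0

  *ₚ-∷ : ∀ p b q → p *ₚ (b ∷ q) ≈ₚ b · p +ₚ (0# ∷ (p *ₚ q))
  *ₚ-∷ []      b q = ≈ₚ-sym 0∷0
  *ₚ-∷ (a ∷ p) b q = ∷-cong (+-congʳ (*-comm a b)) (begin
    a · q +ₚ p *ₚ (b ∷ q)                  ≈⟨ +ₚ-cong ≈ₚ-refl (*ₚ-∷ p b q) ⟩
    a · q +ₚ (b · p +ₚ (0# ∷ (p *ₚ q)))    ≈⟨ +P.x∙yz≈y∙xz (a · q) (b · p) _ ⟩
    b · p +ₚ (a · q +ₚ (0# ∷ (p *ₚ q)))    ∎)
    where open ≈P

  *ₚ-comm : ∀ p q → p *ₚ q ≈ₚ q *ₚ p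
  *ₚ-comm []      q = ≈ₚ-sym (*ₚ-zeroʳ q)
  *ₚ-comm (a ∷ p) q =
    ≈ₚ-trans (+ₚ-cong ≈ₚ-refl (∷-cong refl (*ₚ-comm p q))) (≈ₚ-sym (*ₚ-∷ q a p))

  *ₚ-cong : ∀ {p p′ q q′} → p ≈ₚ p′ → q ≈ₚ q′ → p *ₚ q ≈ₚ p′ *ₚ q′
  *ₚ-cong {p} {p′} {q} {q′} e e′ = begin
    p *ₚ q    ≈⟨ *ₚ-congˡ p e′ ⟩
    p *ₚ q′   ≈⟨ *ₚ-comm p q′ ⟩
    q′ *ₚ p   ≈⟨ *ₚ-congˡ q′ e ⟩
    q′ *ₚ p′  ≈⟨ *ₚ-comm q′ p′ ⟩
    p′ *ₚ q′  ∎
    where open ≈P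

  *ₚ-distribˡ : ∀ p q r → p *ₚ (q +ₚ r) ≈ₚ p *ₚ q +ₚ p *ₚ r
  *ₚ-distribˡ []      q r = ≈ₚ-refl
  *ₚ-distribˡ (a ∷ p) q r = begin
    a · (q +ₚ r) +ₚ (0# ∷ (p *ₚ (q +ₚ r)))
      ≈⟨ +ₚ-cong (·-distribˡ a q r) (∷-cong refl (*ₚ-distribˡ p q r)) ⟩
    (a · q +ₚ a · r) +ₚ (0# ∷ (p *ₚ q +ₚ p *ₚ r))
      ≈⟨ +ₚ-cong ≈ₚ-refl (0∷-distrib (p *ₚ q) (p *ₚ r)) ⟩
    (a · q +ₚ a · r) +ₚ ((0# ∷ (p *ₚ q)) +ₚ (0# ∷ (p *ₚ r)))
      ≈⟨ +P.interchange (a · q) (a · r) _ _ ⟩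
    (a · q +ₚ (0# ∷ (p *ₚ q))) +ₚ (a · r +ₚ (0# ∷ (p *ₚ r))) ∎
    where open ≈P

  *ₚ-distribʳ : ∀ p q r → (q +ₚ r) *ₚ p ≈ₚ q *ₚ p +ₚ r *ₚ p
  *ₚ-distribʳ p q r = begin
    (q +ₚ r) *ₚ p      ≈⟨ *ₚ-comm (q +ₚ r) p ⟩
    p *ₚ (q +ₚ r)      ≈⟨ *ₚ-distribˡ p q r ⟩
    p *ₚ q +ₚ p *ₚ r   ≈⟨ +ₚ-cong (*ₚ-comm p q) (*ₚ-comm p r) ⟩
    q *ₚ p +ₚ r *ₚ p   ∎
    where open ≈P

  ·-*ₚ : ∀ a p q → (a · p) *ₚ q ≈ₚ a · (p *ₚ q)
  ·-*ₚ a []      q = ≈ₚ-refl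
  ·-*ₚ a (b ∷ p) q = begin
    (a * b) · q +ₚ (0# ∷ ((a · p) *ₚ q))     ≈⟨ +ₚ-cong (·-assoc a b q) (∷-cong (sym (zeroʳ a)) (·-*ₚ a p q)) ⟩
    a · (b · q) +ₚ (a · (0# ∷ (p *ₚ q)))     ≈⟨ ·-distribˡ a (b · q) (0# ∷ (p *ₚ q)) ⟨
    a · (b · q +ₚ (0# ∷ (p *ₚ q)))           ∎
    where open ≈P

  0∷-*ₚ : ∀ p q → (0# ∷ p) *ₚ q ≈ₚ 0# ∷ (p *ₚ q)
  0∷-*ₚ p q = +ₚ-cong (·-zeroˡ q) ≈ₚ-refl

  *ₚ-assoc : ∀ p q r → (p *ₚ q) *ₚ r ≈ₚ p *ₚ (q *ₚ r)
  *ₚ-assoc []      q r = ≈ₚ-refl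
  *ₚ-assoc (a ∷ p) q r = begin
    (a · q +ₚ (0# ∷ (p *ₚ q))) *ₚ r            ≈⟨ *ₚ-distribʳ r (a · q) (0# ∷ (p *ₚ q)) ⟩
    (a · q) *ₚ r +ₚ (0# ∷ (p *ₚ q)) *ₚ r       ≈⟨ +ₚ-cong (·-*ₚ a q r) (0∷-*ₚ (p *ₚ q) r) ⟩
    a · (q *ₚ r) +ₚ (0# ∷ ((p *ₚ q) *ₚ r))     ≈⟨ +ₚ-cong ≈ₚ-refl (∷-cong refl (*ₚ-assoc p q r)) ⟩
    a · (q *ₚ r) +ₚ (0# ∷ (p *ₚ (q *ₚ r)))     ∎
    where open ≈P

  *ₚ-identityˡ : ∀ p → 1ₚ *ₚ p ≈ₚ p
  *ₚ-identityˡ p = begin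
    1# · p +ₚ (0# ∷ 0ₚ)   ≈⟨ +ₚ-cong (·-identityˡ p) 0∷0 ⟩
    p +ₚ 0ₚ               ≈⟨ +ₚ-identityʳ p ⟩
    p                     ∎
    where open ≈P

  *ₚ-identityʳ : ∀ p → p *ₚ 1ₚ ≈ₚ p
  *ₚ-identityʳ p = ≈ₚ-trans (*ₚ-comm p 1ₚ) (*ₚ-identityˡ p)

  R[X] : CommutativeRing c ℓ
  R[X] = record
    { Carrier = Poly ; _≈_ = _≈ₚ_ ; _+_ = _+ₚ_ ; _*_ = _*ₚ_
    ; -_ = -ₚ_ ; 0# = 0ₚ ; 1# = 1ₚ
    ; isCommutativeRing = record
      { isRing = record
        { +-isAbelianGroup = record
          { isGroup = record
            { isMonoid = CommutativeMonoid.isMonoid +ₚ-commutativeMonoid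
            ; inverse = -ₚ-inverseˡ , -ₚ-inverseʳ
            ; ⁻¹-cong = -ₚ-cong }
          ; comm = +ₚ-comm }
        ; *-cong = *ₚ-cong
        ; *-assoc = *ₚ-assoc
        ; *-identity = *ₚ-identityˡ , *ₚ-identityʳ
        ; distrib = *ₚ-distribˡ , *ₚ-distribʳ }
      ; *-comm = *ₚ-comm } }

  open FiniteSums R[X] public using () renaming (∏ to ∏ₚ)

  open Monic

  monic-* : ∀ {p q} (mp : Monic p) (mq : Monic q) →
            Σ (Monic (p *ₚ q)) λ m → degree m ≡ degree mp ℕ.+ degree mq
  monic-* {p} {q} mp mq = record { degree = d ℕ.+ e ; leading = lead p d mp.leading mp.above ; above = abv p d mp.leading mp.above } , ≡.refl
    where
    module mp = Monic mp
    module mq = Monic mq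
    d = mp.degree
    e = mq.degree
    const : ∀ a p → a ≈ 1# → (∀ k → 0 ℕ.< k → coeff (a ∷ p) k ≈ 0#) → (a ∷ p) *ₚ q ≈ₚ q
    const a p a≈1 z = ≈ₚ-trans (*ₚ-cong {a ∷ p} {1ₚ} (∷-cong a≈1 (coeffwise λ k → z (suc k) z<s)) ≈ₚ-refl) (*ₚ-identityˡ q)
    lead : ∀ p d → coeff p d ≈ 1# → (∀ k → d ℕ.< k → coeff p k ≈ 0#) → coeff (p *ₚ q) (d ℕ.+ e) ≈ 1#
    lead []      d       l z = l
    lead (a ∷ p) zero    l z = trans (const a p l z .at e) mq.leading
    lead (a ∷ p) (suc d) l z = begin
      coeff (a · q +ₚ (0# ∷ (p *ₚ q))) (suc (d ℕ.+ e))       ≈⟨ coeff-+ (a · q) _ (suc (d ℕ.+ e)) ⟩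
      coeff (a · q) (suc (d ℕ.+ e)) + coeff (p *ₚ q) (d ℕ.+ e)
        ≈⟨ +-cong (trans (coeff-· a q _) (trans (*-congˡ (mq.above _ (s≤s (ℕₚ.m≤n+m e d)))) (zeroʳ a))) (lead p d l (λ k h → z (suc k) (s<s h))) ⟩
      0# + 1#                                               ≈⟨ +-identityˡ 1# ⟩
      1#                                                    ∎
      where open ≈R
    abv : ∀ p d → coeff p d ≈ 1# → (∀ k → d ℕ.< k → coeff p k ≈ 0#) → ∀ k → d ℕ.+ e ℕ.< k → coeff (p *ₚ q) k ≈ 0#
    abv []      d       l z k       h       = refl
    abv (a ∷ p) zero    l z k       h       = trans (const a p l z .at k) (mq.above k h)
    abv (a ∷ p) (suc d) l z (suc k) (s<s h) = begin
      coeff (a · q +ₚ (0# ∷ (p *ₚ q))) (suc k)    ≈⟨ coeff-+ (a · q) _ (suc k) ⟩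
      coeff (a · q) (suc k) + coeff (p *ₚ q) k
        ≈⟨ +-cong (trans (coeff-· a q _) (trans (*-congˡ (mq.above _ (s≤s (ℕₚ.≤-trans (ℕₚ.m≤n+m e d) (ℕₚ.<⇒≤ h))))) (zeroʳ a))) (abv p d l (λ k h → z (suc k) (s<s h)) k h) ⟩
      0# + 0#                                     ≈⟨ +-identityˡ 0# ⟩
      0#                                          ∎
      where open ≈R

  monic-∏ : ∀ {n} (fs : Vector Poly n) (ms : ∀ i → Monic (fs i)) →
            Σ (Monic (∏ₚ fs)) λ m → degree m ≡ totalℕ (λ i → degree (ms i))
  monic-∏ {zero}  fs ms = record { degree = 0 ; leading = refl ; above = λ { (suc k) _ → refl } } , ≡.refl
  monic-∏ {suc n} fs ms with monic-∏ (fs ∘ suc) (ms ∘ suc)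
  ... | m , e with monic-* (ms zero) m
  ... | m′ , e′ = m′ , ≡.trans e′ (≡.cong (degree (ms zero) ℕ.+_) e)

  degree-unique : ¬ (1# ≈ 0#) → ∀ {p q} → p ≈ₚ q → (mp : Monic p) (mq : Monic q) → degree mp ≡ degree mq
  degree-unique 1≉0 {p} {q} e mp mq with ℕₚ.<-cmp (degree mp) (degree mq)
  ... | tri< h _ _ = ⊥-elim (1≉0 (trans (sym (leading mq)) (trans (sym (e .at _)) (above mp _ h))))
  ... | tri≈ _ h _ = h
  ... | tri> _ _ h = ⊥-elim (1≉0 (trans (sym (leading mp)) (trans (e .at _) (above mq _ h))))

  degree-∏ : ¬ (1# ≈ 0#) → ∀ {n f} (fs : Vector Poly n) → f ≈ₚ ∏ₚ fs →
             (mf : Monic f) (ms : ∀ i → Monic (fs i)) → degree mf ≡ totalℕ (λ i → degree (ms i))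
  degree-∏ 1≉0 fs e mf ms =
    ≡.trans (degree-unique 1≉0 e mf (proj₁ (monic-∏ fs ms))) (proj₂ (monic-∏ fs ms))

module LinearAlgebra (R : CommutativeRing c ℓ) where
  open CommutativeRing R hiding (zero)
  open FiniteSums R

  ∑ᴹ : (M : Module R m ℓm) → ∀ {n} → Vector (Module.Carrierᴹ M) n → Module.Carrierᴹ M
  ∑ᴹ M = RawMonoidDefs.sum (Module.+ᴹ-rawMonoid M)

  -- The fields coord, expand and unique together say that vec is a basis:
  -- each element is a linear combination of it with unique coefficients.
  record Basis (M : Module R m ℓm) (n : ℕ) : Set (c ⊔ ℓ ⊔ m ⊔ ℓm) where
    open Module M
    field
      vec    : Vector Carrierᴹ n
      coord  : Carrierᴹ → Vector Carrier n
      expand : ∀ x → x ≈ᴹ ∑ᴹ M (λ k → coord x k *ₗ vec k)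
      unique : ∀ x (a : Vector Carrier n) → x ≈ᴹ ∑ᴹ M (λ k → a k *ₗ vec k) → ∀ k → a k ≈ coord x k

  record LinearMap (M N : Module R m ℓm) : Set (c ⊔ m ⊔ ℓm) where
    open ModuleMorphisms (Module.rawModule M) (Module.rawModule N) using (IsModuleHomomorphism)
    field
      ⟦_⟧                  : Module.Carrierᴹ M → Module.Carrierᴹ N
      isModuleHomomorphism : IsModuleHomomorphism ⟦_⟧

  Matrix : ℕ → ℕ → Set c
  Matrix r s = Fin r → Fin s → Carrier

  -- Columns are the coordinates of the images of the source basis.
  matrixOf : {M N : Module R m ℓm} → ∀ {r s} → Basis M s → Basis N r → LinearMap M N → Matrix r s
  matrixOf b b′ φ i j = Basis.coord b′ (LinearMap.⟦_⟧ φ (Basis.vec b j)) i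

  open Exp semiring using (_^_)

  -- Laplace expansion along the first row.
  det : ∀ {n} → Matrix n n → Carrier
  det {zero}  A = 1#
  det {suc n} A = ∑ λ j → (- 1#) ^ toℕ j * (A zero j * det (λ i k → A (suc i) (punchIn j k)))

  ⨁ : ∀ {n} → (Fin n → Module R m ℓm) → Module R m ℓm
  ⨁ {m} {ℓm} {n} M = record
    { Carrierᴹ = ∀ i → M.Carrierᴹ i
    ; _≈ᴹ_ = λ x y → ∀ i → M._≈ᴹ_ i (x i) (y i)
    ; _+ᴹ_ = λ x y i → M._+ᴹ_ i (x i) (y i)
    ; _*ₗ_ = λ a x i → M._*ₗ_ i a (x i)
    ; _*ᵣ_ = λ x a i → M._*ₗ_ i a (x i)
    ; 0ᴹ = λ i → M.0ᴹ i
    ; -ᴹ_ = λ x i → M.-ᴹ_ i (x i)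
    ; isModule = IsModuleFromLeft.isModule {commutativeRing = R} (record { isLeftModule = record
      { isLeftSemimodule = record
        { +ᴹ-isCommutativeMonoid = record
          { isMonoid = record
            { isSemigroup = record
              { isMagma = record
                { isEquivalence = record
                  { refl = λ i → M.≈ᴹ-refl i
                  ; sym = λ e i → M.≈ᴹ-sym i (e i)
                  ; trans = λ e e′ i → M.≈ᴹ-trans i (e i) (e′ i) }
                ; ∙-cong = λ e e′ i → M.+ᴹ-cong i (e i) (e′ i) }
              ; assoc = λ x y z i → M.+ᴹ-assoc i (x i) (y i) (z i) }
            ; identity = (λ x i → M.+ᴹ-identityˡ i (x i)) , (λ x i → M.+ᴹ-identityʳ i (x i)) }
          ; comm = λ x y i → M.+ᴹ-comm i (x i) (y i) }
        ; isPreleftSemimodule = record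
          { *ₗ-cong = λ e e′ i → M.*ₗ-cong i e (e′ i)
          ; *ₗ-zeroˡ = λ x i → M.*ₗ-zeroˡ i (x i)
          ; *ₗ-distribʳ = λ x a b i → M.*ₗ-distribʳ i (x i) a b
          ; *ₗ-identityˡ = λ x i → M.*ₗ-identityˡ i (x i)
          ; *ₗ-assoc = λ a b x i → M.*ₗ-assoc i a b (x i)
          ; *ₗ-zeroʳ = λ a i → M.*ₗ-zeroʳ i a
          ; *ₗ-distribˡ = λ a x y i → M.*ₗ-distribˡ i a (x i) (y i) } }
      ; -ᴹ‿cong = λ e i → M.-ᴹ‿cong i (e i)
      ; -ᴹ‿inverse = (λ x i → M.-ᴹ‿inverseˡ i (x i)) , (λ x i → M.-ᴹ‿inverseʳ i (x i)) } }) }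
    where module M i = Module (M i)

  module _ (M : Module R m ℓm) where
    open Module M
    open MonoidSum +ᴹ-commutativeMonoid using (sum-cong-≋; sum-replicate-zero)

    ∑-cong : ∀ {n} {x y : Vector Carrierᴹ n} → (∀ k → x k ≈ᴹ y k) → ∑ᴹ M x ≈ᴹ ∑ᴹ M y
    ∑-cong = sum-cong-≋

    ∑-zero : ∀ {n} (x : Vector Carrierᴹ n) → (∀ k → x k ≈ᴹ 0ᴹ) → ∑ᴹ M x ≈ᴹ 0ᴹ
    ∑-zero {n} x e = ≈ᴹ-trans (sum-cong-≋ e) (sum-replicate-zero n)

    ∑-split : ∀ r s (x : Vector Carrierᴹ (r ℕ.+ s)) →
              ∑ᴹ M x ≈ᴹ ∑ᴹ M (λ k → x (k ↑ˡ s)) +ᴹ ∑ᴹ M (λ k → x (r ↑ʳ k))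
    ∑-split zero    s x = ≈ᴹ-sym (+ᴹ-identityˡ _)
    ∑-split (suc r) s x = ≈ᴹ-trans (+ᴹ-congˡ (∑-split r s (x ∘ suc))) (≈ᴹ-sym (+ᴹ-assoc _ _ _))

  ∑-component : ∀ {n r} (M : Fin n → Module R m ℓm) (x : Vector (∀ i → Module.Carrierᴹ (M i)) r) i →
                ∑ᴹ (⨁ M) x i ≡ ∑ᴹ (M i) (λ k → x k i)
  ∑-component {r = zero}  M x i = ≡.refl
  ∑-component {r = suc r} M x i = ≡.cong (Module._+ᴹ_ (M i) (x zero i)) (∑-component M (x ∘ suc) i)

  module _ {n} (M : Fin (suc n) → Module R m ℓm) where
    inFirst : Module.Carrierᴹ (M zero) → Module.Carrierᴹ (⨁ M)
    inFirst x zero    = x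
    inFirst x (suc i) = Module.0ᴹ (M (suc i))

    inRest : Module.Carrierᴹ (⨁ (M ∘ suc)) → Module.Carrierᴹ (⨁ M)
    inRest y zero    = Module.0ᴹ (M zero)
    inRest y (suc i) = y i

  module Append {n} (M : Fin (suc n) → Module R m ℓm) {r s} (b₀ : Basis (M zero) r) (b₊ : Basis (⨁ (M ∘ suc)) s) where
    module M i = Module (M i)
    module B₀ = Basis b₀
    module B₊ = Basis b₊

    vec : Vector (Module.Carrierᴹ (⨁ M)) (r ℕ.+ s)
    vec = (λ k → inFirst M (B₀.vec k)) ++ (λ k → inRest M (B₊.vec k))

    coord : Module.Carrierᴹ (⨁ M) → Vector Carrier (r ℕ.+ s)
    coord x = B₀.coord (x zero) ++ B₊.coord (x ∘ suc)

    combination : ∀ (a : Vector Carrier (r ℕ.+ s)) i →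
      M._≈ᴹ_ i (∑ᴹ (⨁ M) (λ k → Module._*ₗ_ (⨁ M) (a k) (vec k)) i)
               (M._+ᴹ_ i (∑ᴹ (M i) (λ k → M._*ₗ_ i (a (k ↑ˡ s)) (inFirst M (B₀.vec k) i)))
                         (∑ᴹ (M i) (λ k → M._*ₗ_ i (a (r ↑ʳ k)) (inRest M (B₊.vec k) i))))
    combination a i rewrite ∑-component M (λ k → Module._*ₗ_ (⨁ M) (a k) (vec k)) i =
      M.≈ᴹ-trans i (∑-split (M i) r s _)
        (M.+ᴹ-cong i
          (∑-cong (M i) λ k → M.≈ᴹ-reflexive i (≡.cong (λ z → M._*ₗ_ i (a (k ↑ˡ s)) (pick z i)) (splitAt-↑ˡ r k s)))
          (∑-cong (M i) λ k → M.≈ᴹ-reflexive i (≡.cong (λ z → M._*ₗ_ i (a (r ↑ʳ k)) (pick z i)) (splitAt-↑ʳ r s k))))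
      where
      pick : Fin r ⊎ Fin s → Module.Carrierᴹ (⨁ M)
      pick = [ (λ k → inFirst M (B₀.vec k)) , (λ k → inRest M (B₊.vec k)) ]

    combination-zero : ∀ (a : Vector Carrier (r ℕ.+ s)) →
      M._≈ᴹ_ zero (∑ᴹ (⨁ M) (λ k → Module._*ₗ_ (⨁ M) (a k) (vec k)) zero)
                  (∑ᴹ (M zero) (λ k → M._*ₗ_ zero (a (k ↑ˡ s)) (B₀.vec k)))
    combination-zero a = M.≈ᴹ-trans zero (combination a zero)
      (M.≈ᴹ-trans zero (M.+ᴹ-congˡ zero (∑-zero (M zero) (λ k → M._*ₗ_ zero (a (r ↑ʳ k)) (M.0ᴹ zero)) (λ k → M.*ₗ-zeroʳ zero _))) (M.+ᴹ-identityʳ zero _))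

    combination-suc : ∀ (a : Vector Carrier (r ℕ.+ s)) i →
      M._≈ᴹ_ (suc i) (∑ᴹ (⨁ M) (λ k → Module._*ₗ_ (⨁ M) (a k) (vec k)) (suc i))
                     (∑ᴹ (⨁ (M ∘ suc)) (λ k → Module._*ₗ_ (⨁ (M ∘ suc)) (a (r ↑ʳ k)) (B₊.vec k)) i)
    combination-suc a i = M.≈ᴹ-trans (suc i) (combination a (suc i))
      (M.≈ᴹ-trans (suc i) (M.+ᴹ-congʳ (suc i) (∑-zero (M (suc i)) (λ k → M._*ₗ_ (suc i) (a (k ↑ˡ s)) (M.0ᴹ (suc i))) (λ k → M.*ₗ-zeroʳ (suc i) _)))
      (M.≈ᴹ-trans (suc i) (M.+ᴹ-identityˡ (suc i) _)
      (M.≈ᴹ-reflexive (suc i) (≡.sym (∑-component (M ∘ suc) (λ k → Module._*ₗ_ (⨁ (M ∘ suc)) (a (r ↑ʳ k)) (B₊.vec k)) i)))))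

    coord-↑ˡ : ∀ x k → coord x (k ↑ˡ s) ≡ B₀.coord (x zero) k
    coord-↑ˡ x k = ≡.cong [ B₀.coord (x zero) , B₊.coord (x ∘ suc) ] (splitAt-↑ˡ r k s)

    coord-↑ʳ : ∀ x k → coord x (r ↑ʳ k) ≡ B₊.coord (x ∘ suc) k
    coord-↑ʳ x k = ≡.cong [ B₀.coord (x zero) , B₊.coord (x ∘ suc) ] (splitAt-↑ʳ r s k)

    basis : Basis (⨁ M) (r ℕ.+ s)
    basis = record { vec = vec ; coord = coord ; expand = expand ; unique = unique }
      where
      expand : ∀ x i → M._≈ᴹ_ i (x i) (∑ᴹ (⨁ M) (λ k → Module._*ₗ_ (⨁ M) (coord x k) (vec k)) i)
      expand x zero = M.≈ᴹ-trans zero (B₀.expand (x zero))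
        (M.≈ᴹ-trans zero
          (∑-cong (M zero) λ k → M.*ₗ-congʳ zero (reflexive (≡.sym (coord-↑ˡ x k))))
          (M.≈ᴹ-sym zero (combination-zero (coord x))))
      expand x (suc i) = M.≈ᴹ-trans (suc i) (B₊.expand (x ∘ suc) i)
        (M.≈ᴹ-trans (suc i)
          (∑-cong (⨁ (M ∘ suc)) {x = λ k → Module._*ₗ_ (⨁ (M ∘ suc)) (B₊.coord (x ∘ suc) k) (B₊.vec k)}
            (λ k j → M.*ₗ-congʳ (suc j) (reflexive (≡.sym (coord-↑ʳ x k)))) i)
          (M.≈ᴹ-sym (suc i) (combination-suc (coord x) i)))
      unique : ∀ x (a : Vector Carrier (r ℕ.+ s)) →
               (∀ i → M._≈ᴹ_ i (x i) (∑ᴹ (⨁ M) (λ k → Module._*ₗ_ (⨁ M) (a k) (vec k)) i)) →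
               ∀ k → a k ≈ coord x k
      unique x a e k with splitAt r k in eq
      ... | inj₁ j rewrite ≡.sym (splitAt⁻¹-↑ˡ {r} {s} {k} eq) =
        B₀.unique (x zero) (λ k → a (k ↑ˡ s)) (M.≈ᴹ-trans zero (e zero) (combination-zero a)) j
      ... | inj₂ j rewrite ≡.sym (splitAt⁻¹-↑ʳ {r} {s} {k} eq) =
        B₊.unique (x ∘ suc) (λ k → a (r ↑ʳ k)) (λ i → M.≈ᴹ-trans (suc i) (e (suc i)) (combination-suc a i)) j

  -- The concatenation of the given bases, in the order of the summands.
  ⨁-basis : ∀ {n} (M : Fin n → Module R m ℓm) (d : Vector ℕ n) →
            (∀ i → Basis (M i) (d i)) → Basis (⨁ M) (totalℕ d)
  ⨁-basis {n = zero}  M d b = record { vec = λ () ; coord = λ _ () ; expand = λ _ () ; unique = λ _ _ _ () }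
  ⨁-basis {n = suc n} M d b = Append.basis M (b zero) (⨁-basis (M ∘ suc) (d ∘ suc) (λ i → b (suc i)))

module Quotients (R : CommutativeRing c ℓ) where
  open CommutativeRing R hiding (zero)
  open RingProperties ring using (-‿distribʳ-*; -‿distribˡ-*)
  open Polynomials R
  open LinearAlgebra R
  private
    module P = CommutativeRing R[X]
    module PP = RingProperties P.ring
    module PG = AbelianGroupProperties P.+-abelianGroup
    module P+ = CommutativeSemigroupProperties P.+-commutativeSemigroup
    module ≈P = SetoidReasoning P.setoid
    module ≈R = SetoidReasoning setoid
  open RawMonoidDefs P.*-rawMonoid public using () renaming (_∣_ to _∣ₚ_)

  -- R[X]/(f) has polynomials as representatives and this congruence as equality,
  -- so the natural maps between quotients act as the identity on representatives.
  infix 4 _≈_[mod_]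
  record _≈_[mod_] (p q f : Poly) : Set (c ⊔ ℓ) where
    constructor congruent
    field divides : f ∣ₚ (p P.- q)

  module _ (f : Poly) where

    mod-reflexive : ∀ {p q} → p ≈ₚ q → p ≈ q [mod f ]
    mod-reflexive {p} {q} e = congruent (0ₚ , P.sym (PG.x≈y⇒x∙y⁻¹≈ε e))

    mod-sym : ∀ {p q} → p ≈ q [mod f ] → q ≈ p [mod f ]
    mod-sym {p} {q} (congruent (s , e)) = congruent (-ₚ s , (begin
      -ₚ s *ₚ f        ≈⟨ PP.-‿distribˡ-* s f ⟨
      -ₚ (s *ₚ f)      ≈⟨ P.-‿cong e ⟩
      -ₚ (p P.- q)     ≈⟨ PG.⁻¹-anti-homo‿- p q ⟩
      q P.- p          ∎))
      where open ≈P

    private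
      telescope : ∀ p q r → (p P.- q) +ₚ (q P.- r) ≈ₚ p P.- r
      telescope p q r = begin
        (p P.- q) +ₚ (q P.- r)          ≈⟨ P.+-assoc p (-ₚ q) (q P.- r) ⟩
        p +ₚ (-ₚ q +ₚ (q P.- r))        ≈⟨ P.+-congˡ {p} (P.+-assoc (-ₚ q) q (-ₚ r)) ⟨
        p +ₚ ((-ₚ q +ₚ q) +ₚ -ₚ r)      ≈⟨ P.+-congˡ {p} (P.+-congʳ { -ₚ r} (P.-‿inverseˡ q)) ⟩
        p P.- r                         ∎
        where open ≈P

    mod-trans : ∀ {p q r} → p ≈ q [mod f ] → q ≈ r [mod f ] → p ≈ r [mod f ]
    mod-trans {p} {q} {r} (congruent (s , e)) (congruent (t , e′)) =
      congruent (s +ₚ t , (begin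
        (s +ₚ t) *ₚ f               ≈⟨ P.distribʳ f s t ⟩
        s *ₚ f +ₚ t *ₚ f            ≈⟨ P.+-cong e e′ ⟩
        (p P.- q) +ₚ (q P.- r)      ≈⟨ telescope p q r ⟩
        p P.- r                     ∎))
      where open ≈P

    mod-+-cong : ∀ {p p′ q q′} → p ≈ p′ [mod f ] → q ≈ q′ [mod f ] → p +ₚ q ≈ p′ +ₚ q′ [mod f ]
    mod-+-cong {p} {p′} {q} {q′} (congruent (s , e)) (congruent (t , e′)) =
      congruent (s +ₚ t , (begin
        (s +ₚ t) *ₚ f                        ≈⟨ P.distribʳ f s t ⟩
        s *ₚ f +ₚ t *ₚ f                     ≈⟨ P.+-cong e e′ ⟩
        (p P.- p′) +ₚ (q P.- q′)             ≈⟨ P+.interchange p (-ₚ p′) q (-ₚ q′) ⟩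
        (p +ₚ q) +ₚ (-ₚ p′ +ₚ -ₚ q′)         ≈⟨ P.+-congˡ {p +ₚ q} (PG.⁻¹-∙-comm p′ q′) ⟩
        (p +ₚ q) P.- (p′ +ₚ q′)              ∎))
      where open ≈P

    mod-neg-cong : ∀ {p q} → p ≈ q [mod f ] → -ₚ p ≈ -ₚ q [mod f ]
    mod-neg-cong {p} {q} (congruent (s , e)) = congruent (-ₚ s , (begin
      -ₚ s *ₚ f             ≈⟨ PP.-‿distribˡ-* s f ⟨
      -ₚ (s *ₚ f)           ≈⟨ P.-‿cong e ⟩
      -ₚ (p P.- q)          ≈⟨ PG.⁻¹-∙-comm p (-ₚ q) ⟨
      -ₚ p P.- (-ₚ q)       ∎))
      where open ≈P

    mod-·-cong : ∀ {a b p q} → a ≈ b → p ≈ q [mod f ] → a · p ≈ b · q [mod f ]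
    mod-·-cong {a} {b} {p} {q} a≈b (congruent (s , e)) =
      mod-trans (congruent (a · s , (begin
        (a · s) *ₚ f             ≈⟨ ·-*ₚ a s f ⟩
        a · (s *ₚ f)             ≈⟨ ·-cong refl e ⟩
        a · (p P.- q)            ≈⟨ ·-distribˡ a p (-ₚ q) ⟩
        a · p +ₚ a · (-ₚ q)      ≈⟨ P.+-congˡ {a · p} (coeffwise λ k →
                                      trans (coeff-· a (-ₚ q) k) (trans (*-congˡ (coeff-neg q k))
                                      (trans (sym (-‿distribʳ-* _ _)) (trans (-‿cong (sym (coeff-· a q k)))
                                      (sym (coeff-neg (a · q) k)))))) ⟩
        a · p P.- a · q          ∎)))
        (mod-reflexive (·-cong a≈b P.refl))
      where open ≈P

    R[X]/_ : Module R c (c ⊔ ℓ)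
    R[X]/_ = record
      { Carrierᴹ = Poly
      ; _≈ᴹ_ = λ p q → p ≈ q [mod f ]
      ; _+ᴹ_ = _+ₚ_
      ; _*ₗ_ = _·_
      ; _*ᵣ_ = λ p a → a · p
      ; 0ᴹ = 0ₚ
      ; -ᴹ_ = -ₚ_
      ; isModule = IsModuleFromLeft.isModule {commutativeRing = R} (record { isLeftModule = record
        { isLeftSemimodule = record
          { +ᴹ-isCommutativeMonoid = record
            { isMonoid = record
              { isSemigroup = record
                { isMagma = record
                  { isEquivalence = record
                    { refl = mod-reflexive P.refl
                    ; sym = mod-sym
                    ; trans = mod-trans }
                  ; ∙-cong = mod-+-cong }
                ; assoc = λ p q r → mod-reflexive (+ₚ-assoc p q r) }
              ; identity = (λ p → mod-reflexive P.refl) , (λ p → mod-reflexive (+ₚ-identityʳ p)) }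
            ; comm = λ p q → mod-reflexive (+ₚ-comm p q) }
          ; isPreleftSemimodule = record
            { *ₗ-cong = mod-·-cong
            ; *ₗ-zeroˡ = λ p → mod-reflexive (·-zeroˡ p)
            ; *ₗ-distribʳ = λ p a b → mod-reflexive (·-distribʳ p a b)
            ; *ₗ-identityˡ = λ p → mod-reflexive (·-identityˡ p)
            ; *ₗ-assoc = λ a b p → mod-reflexive (·-assoc a b p)
            ; *ₗ-zeroʳ = λ a → mod-reflexive P.refl
            ; *ₗ-distribˡ = λ a p q → mod-reflexive (·-distribˡ a p q) } }
        ; -ᴹ‿cong = mod-neg-cong
        ; -ᴹ‿inverse = (λ p → mod-reflexive (-ₚ-inverseˡ p)) , (λ p → mod-reflexive (-ₚ-inverseʳ p)) } }) }

  factor∣∏ : ∀ {n} (fs : Vector Poly n) i → fs i ∣ₚ ∏ₚ fs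
  factor∣∏ fs zero    = ∏ₚ (fs ∘ suc) , P.*-comm (∏ₚ (fs ∘ suc)) (fs zero)
  factor∣∏ fs (suc i) with factor∣∏ (fs ∘ suc) i
  ... | q , e = fs zero *ₚ q , P.trans (P.*-assoc (fs zero) q (fs (suc i))) (P.*-congˡ {fs zero} e)

  mod-factor : ∀ {n} {f : Poly} (fs : Vector Poly n) → f ≈ₚ ∏ₚ fs →
               ∀ {p q} → p ≈ q [mod f ] → ∀ i → p ≈ q [mod fs i ]
  mod-factor {f = f} fs f≈∏ {p} {q} (congruent (s , e)) i with factor∣∏ fs i
  ... | t , e′ = congruent (s *ₚ t , (begin
    (s *ₚ t) *ₚ fs i    ≈⟨ P.*-assoc s t (fs i) ⟩
    s *ₚ (t *ₚ fs i)    ≈⟨ P.*-congˡ {s} e′ ⟩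
    s *ₚ ∏ₚ fs          ≈⟨ P.*-congˡ {s} f≈∏ ⟨
    s *ₚ f              ≈⟨ e ⟩
    p P.- q             ∎))
    where open ≈P

  Ψ : ∀ {n} (f : Poly) (fs : Vector Poly n) → f ≈ₚ ∏ₚ fs →
      LinearMap (R[X]/ f) (⨁ (λ i → R[X]/ fs i))
  Ψ f fs f≈∏ = record
    { ⟦_⟧ = λ h i → h
    ; isModuleHomomorphism = record
      { isBimoduleHomomorphism = record
        { +ᴹ-isGroupHomomorphism = record
          { isMonoidHomomorphism = record
            { isMagmaHomomorphism = record
              { isRelHomomorphism = record { cong = mod-factor fs f≈∏ }
              ; homo = λ p q i → mod-reflexive (fs i) P.refl }
            ; ε-homo = λ i → mod-reflexive (fs i) P.refl }
          ; ⁻¹-homo = λ p i → mod-reflexive (fs i) P.refl }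
        ; *ₗ-homo = λ a p i → mod-reflexive (fs i) P.refl
        ; *ᵣ-homo = λ a p i → mod-reflexive (fs i) P.refl } } }

  coeff-tabulate : ∀ {n} (v : Vector Carrier n) i → coeff (tabulate v) (toℕ i) ≡ v i
  coeff-tabulate v zero    = ≡.refl
  coeff-tabulate v (suc i) = coeff-tabulate (v ∘ suc) i

  coeff-tabulate-≥ : ∀ {n} (v : Vector Carrier n) k → n ℕ.≤ k → coeff (tabulate v) k ≡ 0#
  coeff-tabulate-≥ {zero}  v k       h       = ≡.refl
  coeff-tabulate-≥ {suc n} v (suc k) (s≤s h) = coeff-tabulate-≥ (v ∘ suc) k h

  private
    ∑ₚ : ∀ {n} → Vector Poly n → Poly
    ∑ₚ = FiniteSums.∑ R[X]

    module ∑P = MonoidSum P.+-commutativeMonoid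

    0∷-∑ : ∀ {n} (x : Vector Poly n) → ∑ₚ (λ k → 0# ∷ x k) ≈ₚ 0# ∷ ∑ₚ x
    0∷-∑ {zero}  x = P.sym 0∷0
    0∷-∑ {suc n} x = P.trans (P.+-congˡ {0# ∷ x zero} (0∷-∑ (x ∘ suc))) (P.sym (0∷-distrib (x zero) (∑ₚ (x ∘ suc))))

  ∑-X^ : ∀ {n} (a : Vector Carrier n) → FiniteSums.∑ R[X] (λ k → a k · X^ (toℕ k)) ≈ₚ tabulate a
  ∑-X^ {zero}  a = P.refl
  ∑-X^ {suc n} a = begin
    a zero · X^ 0 +ₚ ∑ₚ (λ k → a (suc k) · (0# ∷ X^ (toℕ k)))
      ≈⟨ P.+-congˡ {a zero · X^ 0} (∑P.sum-cong-≋ {x = λ k → a (suc k) · (0# ∷ X^ (toℕ k))} {y = λ k → 0# ∷ (a (suc k) · X^ (toℕ k))}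
           (λ k → ∷-cong (zeroʳ _) P.refl)) ⟩
    a zero · X^ 0 +ₚ ∑ₚ (λ k → 0# ∷ (a (suc k) · X^ (toℕ k)))
      ≈⟨ P.+-congˡ {a zero · X^ 0} (0∷-∑ (λ k → a (suc k) · X^ (toℕ k))) ⟩
    (a zero * 1# + 0#) ∷ ∑ₚ (λ k → a (suc k) · X^ (toℕ k))
      ≈⟨ ∷-cong (trans (+-identityʳ _) (*-identityʳ _)) (∑-X^ (a ∘ suc)) ⟩
    a zero ∷ tabulate (a ∘ suc) ∎
    where open ≈P

  module Division (g : Poly) (g-monic : Monic g) where
    open Monic g-monic renaming (degree to d)

    reduceTop : Vector Carrier (suc d) → Vector Carrier d
    reduceTop s k = s (inject₁ k) - s (fromℕ d) * coeff g (toℕ k)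

    remainder : Poly → Vector Carrier d
    remainder []      = λ _ → 0#
    remainder (a ∷ p) = reduceTop (a Vector.∷ remainder p)

    quotient : Poly → Poly
    quotient []      = []
    quotient (a ∷ p) = (a Vector.∷ remainder p) (fromℕ d) ∷ quotient p

    reduceTop-correct : ∀ s → tabulate s ≈ₚ s (fromℕ d) · g +ₚ tabulate (reduceTop s)
    reduceTop-correct s .at k = trans (go k (ℕₚ.<-cmp k d))
      (sym (trans (coeff-+ (t · g) (tabulate (reduceTop s)) k) (+-congʳ (coeff-· t g k))))
      where
      t = s (fromℕ d)
      open ≈R
      cancel : ∀ x y → x ≈ y + (x - y)
      cancel x y = begin
        x                ≈⟨ +-identityʳ x ⟨
        x + 0#           ≈⟨ +-congˡ (-‿inverseʳ y) ⟨
        x + (y - y)      ≈⟨ +-assoc x y (- y) ⟨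
        (x + y) - y      ≈⟨ +-congʳ (+-comm x y) ⟩
        (y + x) - y      ≈⟨ +-assoc y x (- y) ⟩
        y + (x - y)      ∎
      go : ∀ k → Tri (k ℕ.< d) (k ≡ d) (d ℕ.< k) → coeff (tabulate s) k ≈ t * coeff g k + coeff (tabulate (reduceTop s)) k
      go k (tri< k<d _ _) = ≡.subst (λ k → coeff (tabulate s) k ≈ t * coeff g k + coeff (tabulate (reduceTop s)) k)
        (toℕ-fromℕ< k<d) (begin
          coeff (tabulate s) (toℕ i)              ≡⟨ ≡.cong (coeff (tabulate s)) (toℕ-inject₁ i) ⟨
          coeff (tabulate s) (toℕ (inject₁ i))    ≡⟨ coeff-tabulate s (inject₁ i) ⟩
          s (inject₁ i)                           ≈⟨ cancel _ _ ⟩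
          t * coeff g (toℕ i) + reduceTop s i     ≡⟨ ≡.cong (t * coeff g (toℕ i) +_) (coeff-tabulate (reduceTop s) i) ⟨
          t * coeff g (toℕ i) + coeff (tabulate (reduceTop s)) (toℕ i) ∎)
        where i = fromℕ< k<d
      go k (tri≈ _ ≡.refl _) = begin
        coeff (tabulate s) d                ≡⟨ ≡.cong (coeff (tabulate s)) (toℕ-fromℕ d) ⟨
        coeff (tabulate s) (toℕ (fromℕ d))  ≡⟨ coeff-tabulate s (fromℕ d) ⟩
        t                                   ≈⟨ *-identityʳ t ⟨
        t * 1#                              ≈⟨ *-congˡ leading ⟨
        t * coeff g d                       ≈⟨ +-identityʳ _ ⟨
        t * coeff g d + 0#                  ≡⟨ ≡.cong (t * coeff g d +_) (coeff-tabulate-≥ (reduceTop s) d ℕₚ.≤-refl) ⟨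
        t * coeff g d + coeff (tabulate (reduceTop s)) d ∎
      go k (tri> _ _ d<k) = begin
        coeff (tabulate s) k                ≡⟨ coeff-tabulate-≥ s k d<k ⟩
        0#                                  ≈⟨ zeroʳ t ⟨
        t * 0#                              ≈⟨ *-congˡ (above k d<k) ⟨
        t * coeff g k                       ≈⟨ +-identityʳ _ ⟨
        t * coeff g k + 0#                  ≡⟨ ≡.cong (t * coeff g k +_) (coeff-tabulate-≥ (reduceTop s) k (ℕₚ.<⇒≤ d<k)) ⟨
        t * coeff g k + coeff (tabulate (reduceTop s)) k ∎

    division : ∀ p → p ≈ₚ quotient p *ₚ g +ₚ tabulate (remainder p)
    division []      = coeffwise (zeros d)
      where
      zeros : ∀ n k → 0# ≈ coeff (tabulate {n = n} (λ _ → 0#)) k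
      zeros zero    k       = refl
      zeros (suc n) zero    = refl
      zeros (suc n) (suc k) = zeros n k
    division (a ∷ p) = begin
      a ∷ p                                                   ≈⟨ ∷-cong refl (division p) ⟩
      a ∷ (quotient p *ₚ g +ₚ tabulate (remainder p))         ≈⟨ ∷-cong (sym (+-identityˡ a)) P.refl ⟩
      (0# ∷ (quotient p *ₚ g)) +ₚ tabulate s                  ≈⟨ P.+-congˡ {0# ∷ (quotient p *ₚ g)} (reduceTop-correct s) ⟩
      (0# ∷ (quotient p *ₚ g)) +ₚ (t · g +ₚ tabulate (reduceTop s)) ≈⟨ P+.x∙yz≈yx∙z (0# ∷ (quotient p *ₚ g)) (t · g) _ ⟩
      (t ∷ quotient p) *ₚ g +ₚ tabulate (reduceTop s)         ∎
      where
      s = a Vector.∷ remainder p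
      t = s (fromℕ d)
      open ≈P

    multiple-small⇒0 : ∀ q → (∀ k → d ℕ.≤ k → coeff (q *ₚ g) k ≈ 0#) → q ≈ₚ 0ₚ
    multiple-small⇒0 []      small = P.refl
    multiple-small⇒0 (a ∷ q) small = P.trans (∷-cong a≈0 q≈0) 0∷0
      where
      open ≈R
      q≈0 : q ≈ₚ 0ₚ
      q≈0 = multiple-small⇒0 q λ k d≤k → begin
        coeff (q *ₚ g) k                              ≈⟨ +-identityˡ _ ⟨
        0# + coeff (q *ₚ g) k                         ≈⟨ +-congʳ (trans (coeff-· a g (suc k)) (trans (*-congˡ (above (suc k) (s≤s d≤k))) (zeroʳ a))) ⟨
        coeff (a · g) (suc k) + coeff (q *ₚ g) k      ≈⟨ coeff-+ (a · g) (0# ∷ (q *ₚ g)) (suc k) ⟨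
        coeff ((a ∷ q) *ₚ g) (suc k)                  ≈⟨ small (suc k) (ℕₚ.m≤n⇒m≤1+n d≤k) ⟩
        0#                                            ∎
      a≈0 : a ≈ 0#
      a≈0 = begin
        a                                             ≈⟨ *-identityʳ a ⟨
        a * 1#                                        ≈⟨ *-congˡ leading ⟨
        a * coeff g d                                 ≈⟨ coeff-· a g d ⟨
        coeff (a · g) d                               ≈⟨ +-identityʳ _ ⟨
        coeff (a · g) d + 0#                          ≈⟨ +-congˡ (P.trans (∷-cong refl (P.*-congʳ {g} q≈0)) 0∷0 .at d) ⟨
        coeff (a · g) d + coeff (0# ∷ (q *ₚ g)) d     ≈⟨ coeff-+ (a · g) (0# ∷ (q *ₚ g)) d ⟨
        coeff ((a ∷ q) *ₚ g) d                        ≈⟨ small d ℕₚ.≤-refl ⟩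
        0#                                            ∎

    residue-unique : ∀ (u v : Vector Carrier d) → tabulate u ≈ tabulate v [mod g ] → ∀ k → u k ≈ v k
    residue-unique u v (congruent (q , e)) k = begin
      u k                            ≡⟨ coeff-tabulate u k ⟨
      coeff (tabulate u) (toℕ k)     ≈⟨ PG.x∙y⁻¹≈ε⇒x≈y (tabulate u) (tabulate v) (P.trans (P.sym e) (P.*-congʳ {g} q≈0)) .at (toℕ k) ⟩
      coeff (tabulate v) (toℕ k)     ≡⟨ coeff-tabulate v k ⟩
      v k                            ∎
      where
      open ≈R
      q≈0 : q ≈ₚ 0ₚ
      q≈0 = multiple-small⇒0 q λ k d≤k → begin
        coeff (q *ₚ g) k                                       ≈⟨ e .at k ⟩
        coeff (tabulate u +ₚ -ₚ tabulate v) k                  ≈⟨ coeff-+ (tabulate u) (-ₚ tabulate v) k ⟩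
        coeff (tabulate u) k + coeff (-ₚ tabulate v) k         ≈⟨ +-congˡ (coeff-neg (tabulate v) k) ⟩
        coeff (tabulate u) k - coeff (tabulate v) k            ≡⟨ ≡.cong₂ _-_ (coeff-tabulate-≥ u k d≤k) (coeff-tabulate-≥ v k d≤k) ⟩
        0# - 0#                                                ≈⟨ -‿inverseʳ 0# ⟩
        0#                                                     ∎

    remainder-correct : ∀ p → p ≈ tabulate (remainder p) [mod g ]
    remainder-correct p = congruent (quotient p , (begin
      quotient p *ₚ g                    ≈⟨ P.+-identityʳ _ ⟨
      quotient p *ₚ g +ₚ 0ₚ              ≈⟨ P.+-congˡ {quotient p *ₚ g} (P.-‿inverseʳ r) ⟨
      quotient p *ₚ g +ₚ (r P.- r)       ≈⟨ P.+-assoc (quotient p *ₚ g) r (-ₚ r) ⟨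
      (quotient p *ₚ g +ₚ r) P.- r       ≈⟨ P.+-congʳ { -ₚ r} (division p) ⟨
      p P.- r                            ∎))
      where
      r = tabulate (remainder p)
      open ≈P

  standardBasis : (g : Poly) (g-monic : Monic g) → Basis (R[X]/ g) (Monic.degree g-monic)
  standardBasis g g-monic = record
    { vec    = λ k → X^ (toℕ k)
    ; coord  = remainder
    ; expand = λ p → mod-trans g (remainder-correct p) (mod-reflexive g (P.sym (∑-X^ (remainder p))))
    ; unique = λ p a e → residue-unique a (remainder p)
        (mod-trans g (mod-reflexive g (P.sym (∑-X^ a))) (mod-trans g (mod-sym g e) (remainder-correct p)))
    }
    where open Division g g-monic

record IsIntegralDomain (R : CommutativeRing c ℓ) : Set (c ⊔ ℓ) where
  open CommutativeRing R
  field
    1≉0            : ¬ (1# ≈ 0#)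
    noZeroDivisors : ∀ x y → x * y ≈ 0# → x ≈ 0# ⊎ y ≈ 0#

record IsField (K : CommutativeRing c ℓ) : Set (c ⊔ ℓ) where
  open CommutativeRing K
  field
    1≉0     : ¬ (1# ≈ 0#)
    inverse : ∀ x → ¬ (x ≈ 0#) → ∃[ y ] x * y ≈ 1#

record FractionField (R : CommutativeRing c ℓ) c₁ ℓ₁ : Set (c ⊔ ℓ ⊔ lsuc (c₁ ⊔ ℓ₁)) where
  private module R = CommutativeRing R
  field
    ring    : CommutativeRing c₁ ℓ₁
    isField : IsField ring
  open CommutativeRing ring using (Carrier; _≈_; _*_; rawRing)
  field
    ι                  : R.Carrier → Carrier
    isRingMonomorphism : IsRingMonomorphism R.rawRing rawRing ι
    isFraction         : ∀ x → ∃[ a ] ∃[ b ] (¬ (b R.≈ R.0#) × x * ι b ≈ ι a)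

-- Nonconstant means: some coefficient of positive index is nonzero.
AlgebraicallyClosed : CommutativeRing c ℓ → Set (c ⊔ ℓ)
AlgebraicallyClosed K = ∀ p k → ¬ (coeff p (suc k) ≈ 0#) → ∃[ x ] eval p x ≈ 0#
  where
  open CommutativeRing K
  open Polynomials K

record AlgebraicClosure (F : CommutativeRing c ℓ) c₁ ℓ₁ : Set (c ⊔ ℓ ⊔ lsuc (c₁ ⊔ ℓ₁)) where
  private
    module F = CommutativeRing F
    module F[X] = Polynomials F
  field
    ring    : CommutativeRing c₁ ℓ₁
    isField : IsField ring
  open CommutativeRing ring using (Carrier; _≈_; 0#; rawRing)
  open Polynomials ring using (eval)
  field
    ι                   : F.Carrier → Carrier
    isRingHomomorphism  : IsRingHomomorphism F.rawRing rawRing ι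
    isAlgebraic         : ∀ x → ∃[ p ] ∃[ k ] (¬ (F[X].coeff p k F.≈ F.0#) × eval (List.map ι p) x ≈ 0#)
    algebraicallyClosed : AlgebraicallyClosed ring

module _ (K : CommutativeRing c ℓ) where
  open CommutativeRing K
  open Polynomials K
  open FiniteSums K

  -- Multiplicities are recorded by the factorisation.
  record Roots (g : Poly) : Set (c ⊔ ℓ) where
    field
      number        : ℕ
      root          : Vector Carrier number
      factorisation : g ≈ₚ ∏ₚ (λ i → X- root i)

  ∏-differences : ∀ {g h} → Roots g → Roots h → Carrier
  ∏-differences ρ σ = ∏ λ i → ∏ λ j → Roots.root ρ i - Roots.root σ j

module Splitting (K : CommutativeRing c ℓ) (K-field : IsField K) (K-closed : AlgebraicallyClosed K) where
  open CommutativeRing K hiding (zero)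
  open RingProperties ring using (-‿distribˡ-*; -‿distribʳ-*)
  open Polynomials K
  private
    module P = CommutativeRing R[X]
    module ≈R = SetoidReasoning setoid
    module ≈P = SetoidReasoning P.setoid
    module +R = CommutativeSemigroupProperties +-commutativeSemigroup

  linearQuotient : Carrier → Poly → Poly
  linearQuotient α []      = []
  linearQuotient α (a ∷ p) = eval p α ∷ linearQuotient α p

  coeff-X-*-zero : ∀ α q → coeff ((X- α) *ₚ q) 0 ≈ - (α * coeff q 0)
  coeff-X-*-zero α q = begin
    coeff ((X- α) *ₚ q) 0               ≈⟨ coeff-+ (- α · q) _ 0 ⟩
    coeff (- α · q) 0 + 0#              ≈⟨ +-identityʳ _ ⟩
    coeff (- α · q) 0                   ≈⟨ coeff-· (- α) q 0 ⟩
    - α * coeff q 0                     ≈⟨ -‿distribˡ-* _ _ ⟨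
    - (α * coeff q 0)                   ∎
    where open ≈R

  coeff-X-*-suc : ∀ α q k → coeff ((X- α) *ₚ q) (suc k) ≈ coeff q k - α * coeff q (suc k)
  coeff-X-*-suc α q k = begin
    coeff ((X- α) *ₚ q) (suc k)                                 ≈⟨ coeff-+ (- α · q) _ (suc k) ⟩
    coeff (- α · q) (suc k) + coeff (1ₚ *ₚ q) k                 ≈⟨ +-cong (coeff-· (- α) q (suc k)) (*ₚ-identityˡ q .at k) ⟩
    - α * coeff q (suc k) + coeff q k                           ≈⟨ +-comm _ _ ⟩
    coeff q k + - α * coeff q (suc k)                           ≈⟨ +-congˡ (-‿distribˡ-* _ _) ⟨
    coeff q k - α * coeff q (suc k)                             ∎
    where open ≈R

  linear-zero : ∀ α p → coeff p 0 ≈ - (α * coeff (linearQuotient α p) 0) + eval p α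
  linear-zero α []      = sym (trans (+-identityʳ _) (trans (-‿cong (zeroʳ α)) (RingProperties.-0#≈0# ring)))
  linear-zero α (a ∷ p) = begin
    a                                              ≈⟨ +-identityʳ a ⟨
    a + 0#                                         ≈⟨ +-congˡ (-‿inverseˡ _) ⟨
    a + (- (α * eval p α) + α * eval p α)          ≈⟨ +R.x∙yz≈y∙xz _ _ _ ⟩
    - (α * eval p α) + (a + α * eval p α)          ∎
    where open ≈R

  linear-suc : ∀ α p k → coeff p (suc k) ≈ coeff (linearQuotient α p) k - α * coeff (linearQuotient α p) (suc k)
  linear-suc α []      k       = sym (trans (+-identityˡ _) (trans (-‿cong (zeroʳ α)) (RingProperties.-0#≈0# ring)))
  linear-suc α (a ∷ p) zero    = trans (linear-zero α p) (+-comm _ _)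
  linear-suc α (a ∷ p) (suc k) = linear-suc α p k

  factor : ∀ α p → eval p α ≈ 0# → p ≈ₚ (X- α) *ₚ linearQuotient α p
  factor α p e .at zero    = trans (linear-zero α p) (trans (+-congˡ e) (trans (+-identityʳ _) (sym (coeff-X-*-zero α (linearQuotient α p)))))
  factor α p e .at (suc k) = trans (linear-suc α p k) (sym (coeff-X-*-suc α (linearQuotient α p) k))

  vanish : ∀ α q n → (∀ k → n ℕ.≤ k → coeff q k ≈ α * coeff q (suc k)) → ∀ k → n ℕ.≤ k → coeff q k ≈ 0#
  vanish α []      n       h k       n≤k       = refl
  vanish α (a ∷ q) zero    h zero    n≤k       =
    trans (h 0 z≤n) (trans (*-congˡ (vanish α q zero (λ k _ → h (suc k) z≤n) 0 z≤n)) (zeroʳ α))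
  vanish α (a ∷ q) zero    h (suc k) n≤k       = vanish α q zero (λ k _ → h (suc k) z≤n) k z≤n
  vanish α (a ∷ q) (suc n) h (suc k) (s≤s n≤k) = vanish α q n (λ k n≤k → h (suc k) (s≤s n≤k)) k n≤k

  splitting : ∀ d g → coeff g d ≈ 1# → (∀ k → d ℕ.< k → coeff g k ≈ 0#) → Roots K g
  splitting zero    g l z = record { number = 0 ; root = λ () ; factorisation = coeffwise λ { zero → l ; (suc k) → z (suc k) z<s } }
  splitting (suc d) g l z = record
    { number = suc (Roots.number ρ)
    ; root = α Vector.∷ Roots.root ρ
    ; factorisation = P.trans (factor α g gα≈0) (P.*-congˡ {X- α} (Roots.factorisation ρ)) }
    where
    found = K-closed g d (λ e → IsField.1≉0 K-field (trans (sym l) e))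
    α = proj₁ found
    gα≈0 = proj₂ found
    q = linearQuotient α g
    open ≈R
    step : ∀ k → coeff q k ≈ coeff g (suc k) + α * coeff q (suc k)
    step k = begin
      coeff q k                                                         ≈⟨ +-identityʳ _ ⟨
      coeff q k + 0#                                                    ≈⟨ +-congˡ (-‿inverseˡ _) ⟨
      coeff q k + (- (α * coeff q (suc k)) + α * coeff q (suc k))       ≈⟨ +-assoc _ _ _ ⟨
      (coeff q k - α * coeff q (suc k)) + α * coeff q (suc k)           ≈⟨ +-congʳ (linear-suc α g k) ⟨
      coeff g (suc k) + α * coeff q (suc k)                             ∎
    q-above : ∀ k → d ℕ.< k → coeff q k ≈ 0#
    q-above = vanish α q (suc d) λ k d<k → trans (step k) (trans (+-congʳ (z (suc k) (s<s d<k))) (+-identityˡ _))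
    q-leading : coeff q d ≈ 1#
    q-leading = trans (step d) (trans (+-cong l (trans (*-congˡ (q-above (suc d) (ℕₚ.n<1+n d))) (zeroʳ α))) (+-identityʳ 1#))
    ρ = splitting d q q-leading q-above

  roots : ∀ {g} → Monic g → Roots K g
  roots {g} m = splitting degree g leading above
    where open Monic m

module Resultants {R : CommutativeRing c ℓ} (F : FractionField R c₁ ℓ₁)
                  (K : AlgebraicClosure (FractionField.ring F) c₂ ℓ₂) where
  private
    module R = CommutativeRing R
    module R[X] = Polynomials R
    module F = FractionField F
    module K where
      open AlgebraicClosure K public
      open CommutativeRing ring public using (Carrier; _≈_; 0#; 1#; refl; sym; trans; rawRing)
    module K[X] = Polynomials K.ring
  open Splitting K.ring K.isField K.algebraicallyClosed using (roots)

  ι : R.Carrier → K.Carrier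
  ι a = K.ι (F.ι a)

  ι-isRingHomomorphism : IsRingHomomorphism R.rawRing K.rawRing ι
  ι-isRingHomomorphism =
    Composition.isRingHomomorphism K.trans (IsRingMonomorphism.isRingHomomorphism F.isRingMonomorphism) K.isRingHomomorphism

  private module ι = IsRingHomomorphism ι-isRingHomomorphism

  coeff-map : ∀ p k → K[X].coeff (List.map ι p) k K.≈ ι (R[X].coeff p k)
  coeff-map []      k       = K.sym ι.0#-homo
  coeff-map (a ∷ p) zero    = K.refl
  coeff-map (a ∷ p) (suc k) = coeff-map p k

  monic-map : ∀ {g} → R[X].Monic g → K[X].Monic (List.map ι g)
  monic-map {g} m = record
    { degree  = degree
    ; leading = K.trans (coeff-map g degree) (K.trans (ι.⟦⟧-cong leading) ι.1#-homo)
    ; above   = λ k h → K.trans (coeff-map g k) (K.trans (ι.⟦⟧-cong (above k h)) ι.0#-homo) }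
    where open R[X].Monic m

  -- An element of K: R is identified with its image under ι.
  resultant : ∀ {g h} → R[X].Monic g → R[X].Monic h → K.Carrier
  resultant g-monic h-monic = ∏-differences K.ring (roots (monic-map g-monic)) (roots (monic-map h-monic))

{-# OPTIONS --safe #-}
-- Over the algebraic closure each fᵢ splits, so it suffices to treat a matrix
-- whose j-th column holds, block by block, representatives of wᵢ Xʲ modulo
-- products of linear factors, with weights wᵢ (initially 1).  Roots are removed
-- one at a time.  For a root α of the first block, with weight g, subtract α times
-- each column from the next one and perform synthetic division by X − α on the
-- rows of the block: the first row becomes (g(α), 0, …, 0).  Deleting it together
-- with the first column leaves a matrix of the same kind, where the first block
-- has lost the factor X − α and the later weights have gained it.  When a block is
-- exhausted, the weight of every later block has been multiplied by that block's
-- polynomial fᵢ, and evaluating it at the roots of fⱼ gives the resultants ℛ(fⱼ, fᵢ).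
module Submission where

open import Defs
open import Algebra.Bundles using (CommutativeRing)
open import Algebra.Definitions.RawMagma using (_,_)
open import Algebra.Morphism.Structures using (IsRingHomomorphism)
open import Data.Bool.Base using (true; false; if_then_else_)
open import Data.Fin.Base using (Fin; zero; suc; toℕ; inject₁; punchIn; _↑ˡ_; _↑ʳ_)
open import Data.Fin.Properties using (toℕ-inject₁; _<?_)
open import Data.List.Base as List using ([]; _∷_; tabulate)
open import Data.Nat.Base as ℕ using (ℕ; zero; suc; s≤s)
open import Data.Product.Base using (_×_; _,_; proj₁; proj₂)
open import Data.Unit.Polymorphic.Base using (⊤)
open import Data.Vec.Functional using (Vector) renaming (_∷_ to _∷ᵥ_)
open import Function.Base using (_∘_)
open import Level using (Level; _⊔_)
open import Relation.Binary.PropositionalEquality.Core as ≡ using (_≡_; subst)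
open import Relation.Nullary.Decidable using (does)
import Algebra.Properties.AbelianGroup as AbelianGroupProperties
import Algebra.Properties.CommutativeMonoid.Sum as MonoidSum
import Algebra.Properties.CommutativeSemigroup as CommutativeSemigroupProperties
import Algebra.Properties.Ring as RingProperties
import Algebra.Properties.Semiring.Exp as Exp
import Algebra.Properties.Semiring.Sum as SemiringSum
import Relation.Binary.Reasoning.Setoid as SetoidReasoning

private variable
  c ℓ c₁ ℓ₁ : Level

-- Determinants: transposition, equal rows, and the row operations used for elimination.

module Determinants (K : CommutativeRing c ℓ) where
  open CommutativeRing K hiding (zero)
  open FiniteSums K
  open LinearAlgebra K
  open Polynomials K using (eval)
  open Exp semiring using (_^_)
  open SemiringSum semiring using (sum-cong-≋; sum-replicate-zero; ∑-distrib-+; ∑-comm; *-distribˡ-sum)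
  private
    module *R = CommutativeSemigroupProperties *-commutativeSemigroup
  open SetoidReasoning setoid

  ∑-zeros : ∀ {n} (x : Vector Carrier n) → (∀ i → x i ≈ 0#) → ∑ x ≈ 0#
  ∑-zeros {n} x x≈0 = trans (sum-cong-≋ x≈0) (sum-replicate-zero n)

  det-cong : ∀ {n} {A B : Matrix n n} → (∀ i j → A i j ≈ B i j) → det A ≈ det B
  det-cong {zero}  A≈B = refl
  det-cong {suc n} A≈B = sum-cong-≋ λ j →
    *-congˡ {(- 1#) ^ toℕ j} (*-cong (A≈B zero j) (det-cong λ i k → A≈B (suc i) (punchIn j k)))

  -- The corner term is common to both expansions. Every other minor of the first row keeps column
  -- 0, so by induction it expands along that column. Exchanging the two sums gives the same minors
  -- `M i j`, with sign exponent i + j + 1 in either order.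
  det-firstColumn : ∀ {n} (A : Matrix (suc n) (suc n)) →
    det A ≈ ∑ λ i → (- 1#) ^ toℕ i * (A i zero * det λ k l → A (punchIn i k) (suc l))
  det-firstColumn {zero}  A = refl
  det-firstColumn {suc n} A = +-congˡ (begin
    ∑ (λ j → ε (suc j) * (A zero (suc j) * det λ k l → A (suc k) (punchIn (suc j) l)))
      ≈⟨ sum-cong-≋ (λ j → *-congˡ {ε (suc j)} (*-congˡ {A zero (suc j)} (det-firstColumn λ k l → A (suc k) (punchIn (suc j) l)))) ⟩
    ∑ (λ j → ε (suc j) * (A zero (suc j) * ∑ λ i → ε i * (A (suc i) zero * M i j)))
      ≈⟨ sum-cong-≋ (λ j → push (ε (suc j)) (A zero (suc j)) λ i → ε i * (A (suc i) zero * M i j)) ⟩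
    ∑ (λ j → ∑ λ i → ε (suc j) * (A zero (suc j) * (ε i * (A (suc i) zero * M i j))))
      ≈⟨ ∑-comm (λ j i → ε (suc j) * (A zero (suc j) * (ε i * (A (suc i) zero * M i j)))) ⟩
    ∑ (λ i → ∑ λ j → ε (suc j) * (A zero (suc j) * (ε i * (A (suc i) zero * M i j))))
      ≈⟨ sum-cong-≋ (λ i → sum-cong-≋ λ j → shuffle (- 1#) (ε j) (A zero (suc j)) (ε i) (A (suc i) zero) (M i j)) ⟩
    ∑ (λ i → ∑ λ j → ε (suc i) * (A (suc i) zero * (ε j * (A zero (suc j) * M i j))))
      ≈⟨ sum-cong-≋ (λ i → push (ε (suc i)) (A (suc i) zero) λ j → ε j * (A zero (suc j) * M i j)) ⟨
    ∑ (λ i → ε (suc i) * (A (suc i) zero * ∑ λ j → ε j * (A zero (suc j) * M i j))) ∎)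
    where
    ε : ∀ {m} → Fin m → Carrier
    ε i = (- 1#) ^ toℕ i
    M : Matrix (suc n) (suc n)
    M i j = det λ k l → A (suc (punchIn i k)) (suc (punchIn j l))
    push : ∀ {m} x y (z : Vector Carrier m) → x * (y * ∑ z) ≈ ∑ λ i → x * (y * z i)
    push x y z = trans (*-congˡ (*-distribˡ-sum y z)) (*-distribˡ-sum x λ i → y * z i)
    shuffle : ∀ s x a y b m → (s * x) * (a * (y * (b * m))) ≈ (s * y) * (b * (x * (a * m)))
    shuffle s x a y b m = begin
      (s * x) * (a * (y * (b * m))) ≈⟨ *-assoc s x _ ⟩
      s * (x * (a * (y * (b * m)))) ≈⟨ *-congˡ (*-congˡ (*R.x∙yz≈y∙xz a y _)) ⟩
      s * (x * (y * (a * (b * m)))) ≈⟨ *-congˡ (*-congˡ (*-congˡ (*R.x∙yz≈y∙xz a b m))) ⟩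
      s * (x * (y * (b * (a * m)))) ≈⟨ *-congˡ (*R.x∙yz≈y∙xz x y _) ⟩
      s * (y * (x * (b * (a * m)))) ≈⟨ *-congˡ (*-congˡ (*R.x∙yz≈y∙xz x b _)) ⟩
      s * (y * (b * (x * (a * m)))) ≈⟨ *-assoc s y _ ⟨
      (s * y) * (b * (x * (a * m))) ∎

  -- The first-row expansion of the transpose is, term by term, the first-column expansion of `A`
  -- with transposed minors.
  det-transpose : ∀ {n} (A : Matrix n n) → det (λ i j → A j i) ≈ det A
  det-transpose {zero}  A = refl
  det-transpose {suc n} A = trans
    (sum-cong-≋ λ j → *-congˡ {(- 1#) ^ toℕ j} (*-congˡ {A j zero} (det-transpose λ k l → A (punchIn j k) (suc l))))
    (sym (det-firstColumn A))

  -- The first two terms have equal entries and equal minors but opposite signs. All later minors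
  -- still contain both equal columns and vanish by induction.
  det-equalColumns : ∀ {n} (A : Matrix (2 ℕ.+ n) (2 ℕ.+ n)) → (∀ i → A i zero ≈ A i (suc zero)) → det A ≈ 0#
  det-equalColumns {n} A e = begin
    1# * (a * m) + ((- 1# * 1#) * (A zero (suc zero) * m′) + rest)  ≈⟨ +-cong (*-identityˡ _) (+-cong (trans (*-cong (*-identityʳ _) (sym (*-cong (e zero) (det-cong minors)))) (-1*x≈-x _)) (∑-zeros _ (later n A e))) ⟩
    a * m + (- (a * m) + 0#)                                       ≈⟨ +-congˡ (+-identityʳ _) ⟩
    a * m - a * m                                                  ≈⟨ -‿inverseʳ _ ⟩
    0#                                                             ∎
    where
    open RingProperties ring using (-1*x≈-x)
    a = A zero zero
    m = det λ i k → A (suc i) (suc k)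
    m′ = det λ i k → A (suc i) (punchIn (suc zero) k)
    rest = ∑ λ j → (- 1#) ^ (2 ℕ.+ toℕ j) * (A zero (suc (suc j)) * det λ i k → A (suc i) (punchIn (suc (suc j)) k))
    minors : ∀ i k → A (suc i) (suc k) ≈ A (suc i) (punchIn (suc zero) k)
    minors i zero    = sym (e (suc i))
    minors i (suc k) = refl
    later : ∀ n (A : Matrix (2 ℕ.+ n) (2 ℕ.+ n)) → (∀ i → A i zero ≈ A i (suc zero)) → (j : Fin n) →
      (- 1#) ^ (2 ℕ.+ toℕ j) * (A zero (suc (suc j)) * det λ i k → A (suc i) (punchIn (suc (suc j)) k)) ≈ 0#
    -- Matching `suc n` leaves a minor with at least two columns, so the recursive call is
    -- well-typed.
    later (suc n) A e j = trans
      (*-congˡ (trans (*-congˡ (det-equalColumns (λ i k → A (suc i) (punchIn (suc (suc j)) k)) λ i → e (suc i))) (zeroʳ _)))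
      (zeroʳ _)

  det-equalRows : ∀ {n} (A : Matrix (2 ℕ.+ n) (2 ℕ.+ n)) → (∀ j → A zero j ≈ A (suc zero) j) → det A ≈ 0#
  det-equalRows A e = trans (sym (det-transpose A)) (det-equalColumns (λ i j → A j i) e)

  ∑-linear : ∀ {n} a (e p q : Vector Carrier n) →
    ∑ (λ j → e j * (p j + a * q j)) ≈ ∑ (λ j → e j * p j) + a * ∑ (λ j → e j * q j)
  ∑-linear a e p q = begin
    ∑ (λ j → e j * (p j + a * q j))                    ≈⟨ sum-cong-≋ (λ j → trans (distribˡ (e j) (p j) (a * q j)) (+-congˡ (*R.x∙yz≈y∙xz (e j) a (q j)))) ⟩
    ∑ (λ j → e j * p j + a * (e j * q j))              ≈⟨ ∑-distrib-+ (λ j → e j * p j) (λ j → a * (e j * q j)) ⟩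
    ∑ (λ j → e j * p j) + ∑ (λ j → a * (e j * q j))    ≈⟨ +-congˡ (*-distribˡ-sum a λ j → e j * q j) ⟨
    ∑ (λ j → e j * p j) + a * ∑ (λ j → e j * q j)      ∎

  det-row₀ : ∀ {n} a (x y : Vector Carrier (suc n)) (B : Matrix n (suc n)) →
    det ((λ j → x j + a * y j) ∷ᵥ B) ≈ det (x ∷ᵥ B) + a * det (y ∷ᵥ B)
  det-row₀ {n} a x y B = trans
    (sum-cong-≋ λ j → *-congˡ {(- 1#) ^ toℕ j} (trans (distribʳ (m j) (x j) (a * y j)) (+-congˡ (*-assoc a (y j) (m j)))))
    (∑-linear a (λ j → (- 1#) ^ toℕ j) (λ j → x j * m j) (λ j → y j * m j))
    where
    m : Vector Carrier (suc n)
    m j = det λ i k → B i (punchIn j k)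

  -- Expansion along row 0 makes row 1 the first row of every minor, where `det-row₀` applies.
  det-row₁ : ∀ {n} a (x y z : Vector Carrier (2 ℕ.+ n)) (B : Matrix n (2 ℕ.+ n)) →
    det (x ∷ᵥ (λ j → y j + a * z j) ∷ᵥ B) ≈ det (x ∷ᵥ y ∷ᵥ B) + a * det (x ∷ᵥ z ∷ᵥ B)
  det-row₁ {n} a x y z B = trans
    (sum-cong-≋ λ j → *-congˡ {(- 1#) ^ toℕ j} (begin
      x j * det (λ i k → ((λ j → y j + a * z j) ∷ᵥ B) i (punchIn j k))  ≈⟨ *-congˡ (det-row₀ a (λ k → y (punchIn j k)) (λ k → z (punchIn j k)) λ i k → B i (punchIn j k)) ⟩
      x j * (m y j + a * m z j)                                         ≈⟨ distribˡ (x j) (m y j) (a * m z j) ⟩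
      x j * m y j + x j * (a * m z j)                                   ≈⟨ +-congˡ (*R.x∙yz≈y∙xz (x j) a (m z j)) ⟩
      x j * m y j + a * (x j * m z j)                                   ∎))
    (∑-linear a (λ j → (- 1#) ^ toℕ j) (λ j → x j * m y j) (λ j → x j * m z j))
    where
    m : Vector Carrier (2 ℕ.+ n) → Vector Carrier (2 ℕ.+ n)
    m y j = det λ i k → (y ∷ᵥ B) i (punchIn j k)

  absorb : ∀ {x y z} a → x ≈ y + a * z → z ≈ 0# → x ≈ y
  absorb a e z≈0 = trans e (trans (+-congˡ (trans (*-congˡ z≈0) (zeroʳ a))) (+-identityʳ _))

  det-minors : ∀ {n} (A B : Matrix (suc n) (suc n)) → (∀ j → A zero j ≈ B zero j) →
    (∀ j → det (λ i k → A (suc i) (punchIn j k)) ≈ det (λ i k → B (suc i) (punchIn j k))) → det A ≈ det B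
  det-minors A B A₀≈B₀ e = sum-cong-≋ λ j → *-congˡ {(- 1#) ^ toℕ j} (*-cong (A₀≈B₀ j) (e j))

  -- Each row receives a multiple of the original previous row, not of the updated one: on columns
  -- holding w Xʲ this multiplies by a linear factor.
  addPrevious : ∀ {n} → Carrier → Matrix (suc n) (suc n) → Matrix (suc n) (suc n)
  addPrevious a A zero    j = A zero j
  addPrevious a A (suc i) j = A (suc i) j + a * A (inject₁ i) j

  -- The multiple of row 0 in row 1 contributes a determinant with two equal rows. Once it is gone,
  -- the original row 1 heads every minor along row 0, so each minor is again of the form
  -- `addPrevious` and induction applies.
  det-addPrevious : ∀ {n} a (A : Matrix (suc n) (suc n)) → det (addPrevious a A) ≈ det A
  det-addPrevious {zero}  a A = refl
  det-addPrevious {suc n} a A = begin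
    det (addPrevious a A)                       ≈⟨ det-cong split ⟩
    det (x ∷ᵥ (λ j → y j + a * x j) ∷ᵥ B)  ≈⟨ row₁ ⟩
    det (x ∷ᵥ y ∷ᵥ B)               ≈⟨ det-minors (x ∷ᵥ y ∷ᵥ B) A (λ j → refl) (λ j → trans (det-cong (split′ j)) (det-addPrevious a λ i k → A (suc i) (punchIn j k))) ⟩
    det A                                       ∎
    where
    x y : Vector Carrier (2 ℕ.+ n)
    x = A zero
    y = A (suc zero)
    B : Fin n → Vector Carrier (2 ℕ.+ n)
    B i = addPrevious a A (suc (suc i))
    split : ∀ i j → addPrevious a A i j ≈ (x ∷ᵥ (λ j → y j + a * x j) ∷ᵥ B) i j
    split zero          j = refl
    split (suc zero)    j = refl
    split (suc (suc i)) j = refl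
    split′ : ∀ j i k → (y ∷ᵥ B) i (punchIn j k) ≈ addPrevious a (λ i k → A (suc i) (punchIn j k)) i k
    split′ j zero    k = refl
    split′ j (suc i) k = refl
    row₁ : det (x ∷ᵥ (λ j → y j + a * x j) ∷ᵥ B) ≈ det (x ∷ᵥ y ∷ᵥ B)
    row₁ = absorb a (det-row₁ a x y x B) (det-equalRows (x ∷ᵥ x ∷ᵥ B) λ j → refl)

  -- Synthetic division by X − α of the polynomial whose coefficients are the
  -- first d entries: entry 0 becomes its value at α, the next ones its quotient.
  horner : ∀ (α : Carrier) d {s} → Vector Carrier (d ℕ.+ s) → Vector Carrier (d ℕ.+ s)
  horner α zero        v i       = v i
  horner α (suc d) {s} v zero    = eval (tabulate (λ k → v (k ↑ˡ s))) α
  horner α (suc d)     v (suc i) = horner α d (v ∘ suc) i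

  -- By Horner's rule the new row 0 is the old one plus α times the value `y` of the remaining
  -- entries of the block. That value is already the next new row, or zero if no entry remains, so
  -- the extra term drops out; the rows below are handled by induction inside the minors.
  det-horner : ∀ α d {s} (A : Matrix (d ℕ.+ s) (d ℕ.+ s)) → det (λ i j → horner α d (λ k → A k j) i) ≈ det A
  det-horner α zero        A = refl
  det-horner α (suc d) {s} A = begin
    det B                                                 ≈⟨ det-cong split ⟩
    det ((λ j → A zero j + α * y j) ∷ᵥ (B ∘ suc))         ≈⟨ absorb α (det-row₀ α (A zero) y (B ∘ suc)) (top d A) ⟩
    det (A zero ∷ᵥ (B ∘ suc))                             ≈⟨ det-minors (A zero ∷ᵥ (B ∘ suc)) A (λ j → refl) (λ j → det-horner α d λ i k → A (suc i) (punchIn j k)) ⟩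
    det A                                                 ∎
    where
    B : Matrix (suc d ℕ.+ s) (suc d ℕ.+ s)
    B i j = horner α (suc d) (λ k → A k j) i
    y : Vector Carrier (suc d ℕ.+ s)
    y j = eval (tabulate (λ k → A (suc (k ↑ˡ s)) j)) α
    split : ∀ i j → B i j ≈ ((λ j → A zero j + α * y j) ∷ᵥ (B ∘ suc)) i j
    split zero    j = refl
    split (suc i) j = refl
    extended : ∀ d → Matrix (suc d ℕ.+ s) (suc d ℕ.+ s) → Matrix (suc d ℕ.+ s) (suc d ℕ.+ s)
    extended d A = (λ j → eval (tabulate (λ k → A (suc (k ↑ˡ s)) j)) α) ∷ᵥ λ i j → horner α d (λ k → A (suc k) j) i
    top : ∀ d (A : Matrix (suc d ℕ.+ s) (suc d ℕ.+ s)) → det (extended d A) ≈ 0#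
    top zero    A = ∑-zeros (λ j → (- 1#) ^ toℕ j * (0# * det λ i k → A (suc i) (punchIn j k)))
      λ j → trans (*-congˡ {(- 1#) ^ toℕ j} (zeroˡ _)) (zeroʳ _)
    top (suc d) A = det-equalRows (extended (suc d) A) λ j → refl

  horner-↑ʳ : ∀ α d {s} (v : Vector Carrier (d ℕ.+ s)) k → horner α d v (d ↑ʳ k) ≡ v (d ↑ʳ k)
  horner-↑ʳ α zero    v k = ≡.refl
  horner-↑ʳ α (suc d) v k = horner-↑ʳ α d (v ∘ suc) k

  det-pivot : ∀ {n} (A : Matrix (suc n) (suc n)) → (∀ j → A zero (suc j) ≈ 0#) →
    det A ≈ A zero zero * det λ i j → A (suc i) (suc j)
  det-pivot A e = trans
    (+-cong (*-identityˡ _) (∑-zeros _ λ j → trans (*-congˡ {(- 1#) ^ toℕ (suc j)} (trans (*-congʳ (e j)) (zeroˡ _))) (zeroʳ _)))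
    (+-identityʳ _)

-- Evaluation of polynomials as a ring homomorphism that respects congruences at roots of the
-- modulus.

module Evaluation (K : CommutativeRing c ℓ) where
  open CommutativeRing K hiding (zero)
  open Polynomials K
  open Quotients K
  open FiniteSums K
  private
    module P = CommutativeRing R[X]
    module +R = CommutativeSemigroupProperties +-commutativeSemigroup
    module *R = CommutativeSemigroupProperties *-commutativeSemigroup
  open SetoidReasoning setoid

  -- Equality of polynomials ignores trailing zeros, so comparing lists of different lengths comes
  -- down to evaluating a list of zeros.
  eval-zero : ∀ p x → p ≈ₚ 0ₚ → eval p x ≈ 0#
  eval-zero []      x e = refl
  eval-zero (a ∷ p) x e = begin
    a + x * eval p x ≈⟨ +-cong (e .at 0) (trans (*-congˡ (eval-zero p x (coeffwise λ k → e .at (suc k)))) (zeroʳ x)) ⟩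
    0# + 0#          ≈⟨ +-identityˡ 0# ⟩
    0#               ∎

  eval-cong : ∀ {p q} x → p ≈ₚ q → eval p x ≈ eval q x
  eval-cong {[]}    {q}     x e = sym (eval-zero q x (P.sym e))
  eval-cong {a ∷ p} {[]}    x e = eval-zero (a ∷ p) x e
  eval-cong {a ∷ p} {b ∷ q} x e = +-cong (e .at 0) (*-congˡ (eval-cong {p} {q} x (coeffwise λ k → e .at (suc k))))

  eval-+ : ∀ p q x → eval (p +ₚ q) x ≈ eval p x + eval q x
  eval-+ []      q       x = sym (+-identityˡ _)
  eval-+ (a ∷ p) []      x = sym (+-identityʳ _)
  eval-+ (a ∷ p) (b ∷ q) x = begin
    (a + b) + x * eval (p +ₚ q) x            ≈⟨ +-congˡ (trans (*-congˡ (eval-+ p q x)) (distribˡ x _ _)) ⟩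
    (a + b) + (x * eval p x + x * eval q x)  ≈⟨ +R.interchange a b _ _ ⟩
    (a + x * eval p x) + (b + x * eval q x)  ∎

  eval-· : ∀ a p x → eval (a · p) x ≈ a * eval p x
  eval-· a []      x = sym (zeroʳ a)
  eval-· a (b ∷ p) x = begin
    a * b + x * eval (a · p) x    ≈⟨ +-congˡ (trans (*-congˡ (eval-· a p x)) (*R.x∙yz≈y∙xz x a _)) ⟩
    a * b + a * (x * eval p x)    ≈⟨ distribˡ a b _ ⟨
    a * (b + x * eval p x)        ∎

  eval-* : ∀ p q x → eval (p *ₚ q) x ≈ eval p x * eval q x
  eval-* []      q x = sym (zeroˡ _)
  eval-* (a ∷ p) q x = begin
    eval (a · q +ₚ (0# ∷ (p *ₚ q))) x             ≈⟨ eval-+ (a · q) _ x ⟩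
    eval (a · q) x + (0# + x * eval (p *ₚ q) x)   ≈⟨ +-cong (eval-· a q x) (trans (+-identityˡ _) (trans (*-congˡ (eval-* p q x)) (sym (*-assoc x _ _)))) ⟩
    a * eval q x + (x * eval p x) * eval q x      ≈⟨ distribʳ (eval q x) a _ ⟨
    (a + x * eval p x) * eval q x                 ∎

  eval-1 : ∀ x → eval 1ₚ x ≈ 1#
  eval-1 x = trans (+-congˡ (zeroʳ x)) (+-identityʳ 1#)

  eval-X- : ∀ α x → eval (X- α) x ≈ x - α
  eval-X- α x = trans (+-comm _ _) (+-congʳ (trans (*-congˡ (eval-1 x)) (*-identityʳ x)))

  eval-∏ : ∀ {n} (ps : Vector Poly n) x → eval (∏ₚ ps) x ≈ ∏ λ i → eval (ps i) x
  eval-∏ {zero}  ps x = eval-1 x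
  eval-∏ {suc n} ps x = trans (eval-* (ps zero) (∏ₚ (ps ∘ suc)) x) (*-congˡ (eval-∏ (ps ∘ suc) x))

  eval-mod : ∀ {p q f} x → p ≈ q [mod f ] → eval f x ≈ 0# → eval p x ≈ eval q x
  eval-mod {p} {q} {f} x (congruent (s , e)) f≈0 = begin
    eval p x                           ≈⟨ eval-cong x decompose ⟩
    eval (s *ₚ f +ₚ q) x               ≈⟨ eval-+ (s *ₚ f) q x ⟩
    eval (s *ₚ f) x + eval q x         ≈⟨ +-congʳ (trans (eval-* s f x) (trans (*-congˡ f≈0) (zeroʳ _))) ⟩
    0# + eval q x                      ≈⟨ +-identityˡ _ ⟩
    eval q x                           ∎
    where
    decompose : p ≈ₚ s *ₚ f +ₚ q
    decompose = P.sym (P.trans (P.+-congʳ {q} e) (P.trans (P.+-assoc p (-ₚ q) q)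
      (P.trans (P.+-congˡ {p} (P.-‿inverseˡ q)) (P.+-identityʳ p))))

  eval-X-root : ∀ α → eval (X- α) α ≈ 0#
  eval-X-root α = trans (eval-X- α α) (-‿inverseʳ α)

-- Division by X - α and cancellation of this factor.

module SyntheticDivision (K : CommutativeRing c ℓ) where
  open CommutativeRing K hiding (zero)
  open Polynomials K
  open Quotients K
  open Determinants K using (horner)
  open RingProperties ring using (-‿distribˡ-*)
  private
    module P = CommutativeRing R[X]
    module PP = RingProperties P.ring
    module PG = AbelianGroupProperties P.+-abelianGroup
    module P* = CommutativeSemigroupProperties P.*-commutativeSemigroup
  open SetoidReasoning P.setoid

  X-monic : ∀ α → Monic (X- α)
  X-monic α = record { degree = 1 ; leading = refl ; above = λ { (suc zero) (s≤s ()) ; (suc (suc k)) _ → refl } }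

  -- As X - α is monic, `multiple-small⇒0` applies to the multiplier p - q, whose product with X - α
  -- vanishes.
  X-cancelˡ : ∀ α p q → (X- α) *ₚ p ≈ₚ (X- α) *ₚ q → p ≈ₚ q
  X-cancelˡ α p q e = PG.x∙y⁻¹≈ε⇒x≈y p q (Division.multiple-small⇒0 (X- α) (X-monic α) (p P.- q) λ k _ → vanishes .at k)
    where
    vanishes : (p P.- q) *ₚ (X- α) ≈ₚ 0ₚ
    vanishes = P.trans (P.*-comm (p P.- q) (X- α)) (P.trans (PP.x[y-z]≈xy-xz (X- α) p q) (PG.x≈y⇒x∙y⁻¹≈ε e))

  -- The same cofactor `s` witnesses both congruences, since X - α cancels from the equation. This
  -- is how a block's modulus loses a root.
  mod-X-cancel : ∀ α {p q f} → (X- α) *ₚ p ≈ (X- α) *ₚ q [mod (X- α) *ₚ f ] → p ≈ q [mod f ]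
  mod-X-cancel α {p} {q} {f} (congruent (s , e)) = congruent (s , X-cancelˡ α (s *ₚ f) (p P.- q) (begin
    (X- α) *ₚ (s *ₚ f)                ≈⟨ P*.x∙yz≈y∙xz (X- α) s f ⟩
    s *ₚ ((X- α) *ₚ f)                ≈⟨ e ⟩
    (X- α) *ₚ p P.- (X- α) *ₚ q       ≈⟨ PP.x[y-z]≈xy-xz (X- α) p q ⟨
    (X- α) *ₚ (p P.- q)               ∎))

  -- Division with remainder p = (X - α) q + p(α). In the induction the value `h` of the tail is the
  -- constant coefficient of the new quotient, and its contributions -αh and αh to the constant term
  -- cancel.
  horner-division : ∀ α d {s} a (u : Vector Carrier (d ℕ.+ s)) →
    let p = a ∷ tabulate (λ k → u (k ↑ˡ s)) in
    p ≈ₚ (X- α) *ₚ tabulate (λ k → horner α d u (k ↑ˡ s)) +ₚ (eval p α ∷ [])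
  horner-division α zero    a u = P.sym (P.trans (P.+-congʳ {(a + α * 0#) ∷ []} (P.zeroʳ (X- α)))
    (∷-cong (trans (+-congˡ (zeroʳ α)) (+-identityʳ a)) P.refl))
  horner-division α (suc d) {s} a u = begin
    a ∷ p                                                           ≈⟨ ∷-cong (sym constant) (P.trans (horner-division α d (u zero) (u ∘ suc)) (P.+-comm _ (h ∷ []))) ⟩
    ((h * - α + 0#) + (a + α * h)) ∷ ((h ∷ []) +ₚ (X- α) *ₚ q)      ≈⟨ ∷-cong refl (P.+-congʳ {(X- α) *ₚ q} (∷-cong (sym (*-identityʳ h)) P.refl)) ⟩
    ((h * - α + 0#) + (a + α * h)) ∷ ((h * 1# ∷ []) +ₚ (X- α) *ₚ q) ≈⟨ ∷-cong refl (P.+-identityʳ _) ⟨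
    (h · (X- α) +ₚ (0# ∷ ((X- α) *ₚ q))) +ₚ ((a + α * h) ∷ [])      ≈⟨ P.+-congʳ {(a + α * h) ∷ []} (*ₚ-∷ (X- α) h q) ⟨
    (X- α) *ₚ (h ∷ q) +ₚ ((a + α * h) ∷ [])                         ∎
    where
    p q : Poly
    p = tabulate λ k → u (k ↑ˡ s)
    q = tabulate λ k → horner α d (u ∘ suc) (k ↑ˡ s)
    h : Carrier
    h = eval p α
    constant : (h * - α + 0#) + (a + α * h) ≈ a
    constant = trans (+-cong (trans (+-identityʳ _) (trans (*-comm h (- α)) (sym (-‿distribˡ-* α h)))) (+-comm a _))
      (trans (sym (+-assoc _ _ a)) (trans (+-congʳ (-‿inverseˡ _)) (+-identityˡ a)))

  horner-factor : ∀ α d {s} (v : Vector Carrier (suc d ℕ.+ s)) → eval (tabulate λ k → v (k ↑ˡ s)) α ≈ 0# →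
    tabulate (λ k → v (k ↑ˡ s)) ≈ₚ (X- α) *ₚ tabulate (λ k → horner α d (v ∘ suc) (k ↑ˡ s))
  horner-factor α d {s} v e = begin
    tabulate (λ k → v (k ↑ˡ s))       ≈⟨ horner-division α d (v zero) (v ∘ suc) ⟩
    (X- α) *ₚ q +ₚ (_ ∷ [])           ≈⟨ P.+-congˡ {(X- α) *ₚ q} (P.trans (∷-cong e P.refl) 0∷0) ⟩
    (X- α) *ₚ q +ₚ 0ₚ                 ≈⟨ P.+-identityʳ _ ⟩
    (X- α) *ₚ q                       ∎
    where
    q : Poly
    q = tabulate λ k → horner α d (v ∘ suc) (k ↑ˡ s)

-- Matrices whose columns are blocks of residues, and their determinants.

module Blocks (K : CommutativeRing c ℓ) where
  open CommutativeRing K hiding (zero)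
  open FiniteSums K
  open Polynomials K
  open LinearAlgebra K
  open Quotients K
  open Determinants K
  open Evaluation K
  open SyntheticDivision K
  private
    module P = CommutativeRing R[X]
    module P* = CommutativeSemigroupProperties P.*-commutativeSemigroup
    module ∏K = MonoidSum *-commutativeMonoid

  ∏X- : ∀ {d} → Vector Carrier d → Poly
  ∏X- r = ∏ₚ λ k → X- r k

  -- The consecutive blocks of v are coefficients of representatives of p
  -- modulo the polynomials with the given roots.
  Residues : ∀ {n} {ds : Vector ℕ n} → (∀ i → Vector Carrier (ds i)) → Poly → Vector Carrier (totalℕ ds) → Set (c ⊔ ℓ)
  Residues {zero}       rs p v = ⊤
  Residues {suc n} {ds} rs p v =
    p ≈ tabulate (λ k → v (k ↑ˡ totalℕ (ds ∘ suc))) [mod ∏X- (rs zero) ] ×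
    Residues (λ i → rs (suc i)) p (λ k → v (ds zero ↑ʳ k))

  tabulate-cong : ∀ {n} {x y : Vector Carrier n} → (∀ k → x k ≈ y k) → tabulate x ≈ₚ tabulate y
  tabulate-cong {zero}  e = P.refl
  tabulate-cong {suc n} e = ∷-cong (e zero) (tabulate-cong λ k → e (suc k))

  tabulate-linear : ∀ {n} a (x y : Vector Carrier n) → tabulate (λ k → x k + a * y k) ≈ₚ tabulate x +ₚ a · tabulate y
  tabulate-linear {zero}  a x y = P.refl
  tabulate-linear {suc n} a x y = ∷-cong refl (tabulate-linear a (x ∘ suc) (y ∘ suc))

  mod-linear : ∀ {n} f a {p q} (x y : Vector Carrier n) → p ≈ tabulate x [mod f ] → q ≈ tabulate y [mod f ] →
    p +ₚ a · q ≈ tabulate (λ k → x k + a * y k) [mod f ]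
  mod-linear f a x y e e′ = mod-trans f (mod-+-cong f e (mod-·-cong f refl e′)) (mod-reflexive f (P.sym (tabulate-linear a x y)))

  -- Column operations on the matrix thus become linear combinations of the represented polynomials.
  Residues-linear : ∀ {n} {ds : Vector ℕ n} (rs : ∀ i → Vector Carrier (ds i)) a {p q} x y →
    Residues rs p x → Residues rs q y → Residues rs (p +ₚ a · q) (λ k → x k + a * y k)
  Residues-linear {zero}       rs a x y _       _         = _
  Residues-linear {suc n} {ds} rs a x y (e , t) (e′ , t′) =
    mod-linear (∏X- (rs zero)) a (λ k → x (k ↑ˡ _)) (λ k → y (k ↑ˡ _)) e e′ ,
    Residues-linear (λ i → rs (suc i)) a (λ k → x (ds zero ↑ʳ k)) (λ k → y (ds zero ↑ʳ k)) t t′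

  Residues-cong : ∀ {n} {ds : Vector ℕ n} (rs : ∀ i → Vector Carrier (ds i)) {p q x y} →
    p ≈ₚ q → (∀ k → x k ≈ y k) → Residues rs p x → Residues rs q y
  Residues-cong {zero}       rs p≈q x≈y _       = _
  Residues-cong {suc n} {ds} rs p≈q x≈y (e , t) =
    mod-trans f (mod-reflexive f (P.sym p≈q)) (mod-trans f e (mod-reflexive f (tabulate-cong λ k → x≈y (k ↑ˡ _)))) ,
    Residues-cong (λ i → rs (suc i)) p≈q (λ k → x≈y (ds zero ↑ʳ k)) t
    where f = ∏X- (rs zero)

  -- The determinant to be established for starting weight `w`: a block contributes its weight
  -- evaluated at its roots and passes the weight, times its own polynomial, to the later blocks.
  value : ∀ {n} {ds : Vector ℕ n} → (∀ i → Vector Carrier (ds i)) → Poly → Carrier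
  value {zero}  rs w = 1#
  value {suc n} rs w = ∏ (λ k → eval w (rs zero k)) * value (λ i → rs (suc i)) (w *ₚ ∏X- (rs zero))

  value-cong : ∀ {n} {ds : Vector ℕ n} (rs : ∀ i → Vector Carrier (ds i)) {w w′} → w ≈ₚ w′ → value rs w ≈ value rs w′
  value-cong {zero}  rs e = refl
  value-cong {suc n} rs e = *-cong (∏K.sum-cong-≋ λ k → eval-cong (rs zero k) e)
    (value-cong (λ i → rs (suc i)) (P.*-congʳ {∏X- (rs zero)} e))

  -- The effect on a column w Xʲ⁺¹ of subtracting α times its predecessor: a factor X - α splits
  -- off.
  X^-shift : ∀ w α j → w *ₚ X^ (suc j) +ₚ (- α) · (w *ₚ X^ j) ≈ₚ (X- α) *ₚ (w *ₚ X^ j)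
  X^-shift w α j = begin
    w *ₚ X^ (suc j) +ₚ (- α) · (w *ₚ X^ j)    ≈⟨ P.+-congˡ {w *ₚ X^ (suc j)} (P.trans (·-cong refl (P.*-comm w (X^ j))) (P.trans (P.sym (·-*ₚ (- α) (X^ j) w)) (P.*-comm ((- α) · X^ j) w))) ⟩
    w *ₚ X^ (suc j) +ₚ w *ₚ ((- α) · X^ j)    ≈⟨ P.distribˡ w (X^ (suc j)) ((- α) · X^ j) ⟨
    w *ₚ (X^ (suc j) +ₚ (- α) · X^ j)         ≈⟨ P.*-congˡ {w} (P.+-comm (X^ (suc j)) ((- α) · X^ j)) ⟩
    w *ₚ ((- α) · X^ j +ₚ (0# ∷ X^ j))        ≈⟨ P.*-congˡ {w} (P.+-congˡ {(- α) · X^ j} (∷-cong refl (P.*-identityˡ (X^ j)))) ⟨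
    w *ₚ ((X- α) *ₚ X^ j)                     ≈⟨ P*.x∙yz≈y∙xz w (X- α) (X^ j) ⟩
    (X- α) *ₚ (w *ₚ X^ j)                     ∎
    where open SetoidReasoning P.setoid

  -- Two weights are needed because they diverge while roots are removed: `g` of the current block
  -- stays fixed, whereas `h` of the later blocks gains each X - α. Taking the result for the later
  -- blocks as `IH` keeps the recursion on the roots of one block apart from that on the blocks.
  det-block : ∀ {n} {ds : Vector ℕ n} (rs : ∀ i → Vector Carrier (ds i)) →
    (∀ w (M : Matrix (totalℕ ds) (totalℕ ds)) → (∀ j → Residues rs (w *ₚ X^ (toℕ j)) (λ i → M i j)) → det M ≈ value rs w) →
    ∀ d (r : Vector Carrier d) g h (M : Matrix (d ℕ.+ totalℕ ds) (d ℕ.+ totalℕ ds)) →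
    (∀ j → g *ₚ X^ (toℕ j) ≈ tabulate (λ k → M (k ↑ˡ totalℕ ds) j) [mod ∏X- r ]) →
    (∀ j → Residues rs (h *ₚ X^ (toℕ j)) (λ k → M (d ↑ʳ k) j)) →
    det M ≈ ∏ (λ k → eval g (r k)) * value rs (h *ₚ ∏X- r)
  det-block rs IH zero    r g h M _ residues = trans (IH h M residues)
    (trans (value-cong rs (P.sym (P.*-identityʳ h))) (sym (*-identityˡ _)))
  det-block {ds = ds} rs IH (suc d) r g h M residue residues = begin
    -- Transposing turns the row operation `addPrevious` into the required column operation.
    det M                                                       ≈⟨ det-transpose M ⟨
    det (λ j i → M i j)                                         ≈⟨ det-addPrevious (- α) (λ j i → M i j) ⟨
    det (λ j i → M₁ i j)                                        ≈⟨ det-transpose M₁ ⟩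
    det M₁                                                      ≈⟨ det-horner α (suc d) M₁ ⟨
    det M₂                                                      ≈⟨ det-pivot M₂ row₀ ⟩
    M₂ zero zero * det (λ i j → M₂ (suc i) (suc j))             ≈⟨ *-cong corner (det-block rs IH d (r ∘ suc) g (h *ₚ (X- α)) (λ i j → M₂ (suc i) (suc j)) residue′ residues′) ⟩
    eval g α * (∏ (λ k → eval g (r (suc k))) * value rs ((h *ₚ (X- α)) *ₚ f))
                                                                ≈⟨ *-assoc _ _ _ ⟨
    ∏ (λ k → eval g (r k)) * value rs ((h *ₚ (X- α)) *ₚ f)      ≈⟨ *-congˡ (value-cong rs (P.*-assoc h (X- α) f)) ⟩
    ∏ (λ k → eval g (r k)) * value rs (h *ₚ ((X- α) *ₚ f))      ∎
    where
    open SetoidReasoning setoid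
    s = totalℕ ds
    α = r zero
    f = ∏X- (r ∘ suc)
    M₁ M₂ : Matrix (suc d ℕ.+ s) (suc d ℕ.+ s)
    M₁ i j = addPrevious (- α) (λ j i → M i j) j i
    M₂ i j = horner α (suc d) (λ k → M₁ k j) i
    fα≈0 : eval ((X- α) *ₚ f) α ≈ 0#
    fα≈0 = trans (eval-* (X- α) f α) (trans (*-congʳ (eval-X-root α)) (zeroˡ _))
    -- Column 0 has no predecessor, so it still represents g X⁰; its value at α depends only on the
    -- residue because α is a root of the modulus.
    corner : M₂ zero zero ≈ eval g α
    corner = trans (sym (eval-mod α (residue zero) fα≈0)) (eval-cong α (P.*-identityʳ g))
    column : ∀ j → (X- α) *ₚ (g *ₚ X^ (toℕ j)) ≈ tabulate (λ k → M₁ (k ↑ˡ s) (suc j)) [mod (X- α) *ₚ f ]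
    column j = mod-trans ((X- α) *ₚ f) (mod-reflexive ((X- α) *ₚ f) (P.sym (X^-shift g α (toℕ j))))
      (mod-linear ((X- α) *ₚ f) (- α) (λ k → M (k ↑ˡ s) (suc j)) (λ k → M (k ↑ˡ s) (inject₁ j)) (residue (suc j))
        (subst (λ m → g *ₚ X^ m ≈ tabulate (λ k → M (k ↑ˡ s) (inject₁ j)) [mod (X- α) *ₚ f ]) (toℕ-inject₁ j) (residue (inject₁ j))))
    -- The entry is the value at α of a representative of a multiple of X - α, modulo a polynomial
    -- that also vanishes at α.
    row₀ : ∀ j → M₂ zero (suc j) ≈ 0#
    row₀ j = trans (sym (eval-mod α (column j) fα≈0)) (trans (eval-* (X- α) (g *ₚ X^ (toℕ j)) α) (trans (*-congʳ (eval-X-root α)) (zeroˡ _)))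
    -- Since the remainder `row₀ j` is zero, the lower rows hold an exact quotient, and X - α
    -- cancels from both sides and from the modulus.
    residue′ : ∀ j → g *ₚ X^ (toℕ j) ≈ tabulate (λ k → M₂ (suc (k ↑ˡ s)) (suc j)) [mod f ]
    residue′ j = mod-X-cancel α (mod-trans ((X- α) *ₚ f) (column j)
      (mod-reflexive ((X- α) *ₚ f) (horner-factor α d (λ k → M₁ k (suc j)) (row₀ j))))
    -- Synthetic division leaves the later blocks untouched, so they keep the factor X - α, which is
    -- absorbed into their weight.
    residues′ : ∀ j → Residues rs ((h *ₚ (X- α)) *ₚ X^ (toℕ j)) (λ k → M₂ (suc (d ↑ʳ k)) (suc j))
    residues′ j = Residues-cong rs
      (P.trans (X^-shift h α (toℕ j)) (P.trans (P.sym (P.*-assoc (X- α) h (X^ (toℕ j)))) (P.*-congʳ {X^ (toℕ j)} (P.*-comm (X- α) h))))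
      (λ k → reflexive (≡.sym (horner-↑ʳ α d (λ k → M₁ (suc k) (suc j)) k)))
      (Residues-linear rs (- α) (λ k → M (suc d ↑ʳ k) (suc j)) (λ k → M (suc d ↑ʳ k) (inject₁ j)) (residues (suc j))
        (subst (λ m → Residues rs (h *ₚ X^ m) (λ k → M (suc d ↑ʳ k) (inject₁ j))) (toℕ-inject₁ j) (residues (inject₁ j))))

  -- Induction on the number of blocks; at the start of each stage the first block and the later
  -- ones share the weight `w`.
  det-residues : ∀ {n} {ds : Vector ℕ n} (rs : ∀ i → Vector Carrier (ds i)) w (M : Matrix (totalℕ ds) (totalℕ ds)) →
    (∀ j → Residues rs (w *ₚ X^ (toℕ j)) (λ i → M i j)) → det M ≈ value rs w
  det-residues {zero}       rs w M residues = refl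
  det-residues {suc n} {ds} rs w M residues =
    det-block (λ i → rs (suc i)) (det-residues λ i → rs (suc i)) (ds zero) (rs zero) w w M (proj₁ ∘ residues) (proj₂ ∘ residues)

-- From evaluated weights to products of differences of roots.

module Differences (K : CommutativeRing c ℓ) where
  open CommutativeRing K hiding (zero)
  open FiniteSums K
  open Polynomials K
  open Evaluation K
  open Blocks K
  private
    module ∏K = MonoidSum *-commutativeMonoid
  open SetoidReasoning setoid

  ∏-i<j-cong : ∀ {n} {a b : Fin n → Fin n → Carrier} → (∀ i j → a i j ≈ b i j) → ∏-i<j a ≈ ∏-i<j b
  ∏-i<j-cong {a = a} {b} e = ∏K.sum-cong-≋ λ i → ∏K.sum-cong-≋ λ j → branch i j (does (i <? j))
    where
    branch : ∀ i j t → (if t then a i j else 1#) ≈ (if t then b i j else 1#)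
    branch i j true  = e i j
    branch i j false = refl

  -- Index pairs with second index 0 contribute `1#`, and comparing two successors computes to
  -- comparing their predecessors.
  ∏-i<j-suc : ∀ {n} (a : Fin (suc n) → Fin (suc n) → Carrier) →
    ∏-i<j a ≈ ∏ (λ j → a zero (suc j)) * ∏-i<j (λ i j → a (suc i) (suc j))
  ∏-i<j-suc a = *-cong (*-identityˡ (∏ λ j → a zero (suc j)))
    (∏K.sum-cong-≋ λ i → *-identityˡ (∏ λ j → if does (i <? j) then a (suc i) (suc j) else 1#))

  differences : ∀ {m n} → Vector Carrier m → Vector Carrier n → Carrier
  differences r s = ∏ λ k → ∏ λ l → r k - s l

  eval-∏X- : ∀ {n} (s : Vector Carrier n) x → eval (∏X- s) x ≈ ∏ λ l → x - s l
  eval-∏X- s x = trans (eval-∏ (λ l → X- s l) x) (∏K.sum-cong-≋ λ l → eval-X- (s l) x)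

  -- The weight is arbitrary so that induction can absorb the first block. Evaluating `w *ₚ f` at a
  -- later root splits into the value of `w` and the differences with the roots of the first block,
  -- which form the row i = 0 of the double product.
  value-differences : ∀ {n} {ds : Vector ℕ n} (rs : ∀ i → Vector Carrier (ds i)) w →
    value rs w ≈ ∏ (λ i → ∏ λ k → eval w (rs i k)) * ∏-i<j (λ i j → differences (rs j) (rs i))
  value-differences {zero}  rs w = sym (*-identityˡ 1#)
  value-differences {suc n} rs w = begin
    W zero * value (λ i → rs (suc i)) (w *ₚ f)
      ≈⟨ *-congˡ (value-differences (λ i → rs (suc i)) (w *ₚ f)) ⟩
    W zero * (∏ (λ i → ∏ λ k → eval (w *ₚ f) (rs (suc i) k)) * D)
      ≈⟨ *-congˡ (*-congʳ (∏K.sum-cong-≋ λ i → trans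
           (∏K.sum-cong-≋ λ k → trans (eval-* w f (rs (suc i) k)) (*-congˡ (eval-∏X- (rs zero) (rs (suc i) k))))
           (∏K.∑-distrib-+ (λ k → eval w (rs (suc i) k)) (λ k → ∏ λ l → rs (suc i) k - rs zero l)))) ⟩
    W zero * (∏ (λ i → W (suc i) * differences (rs (suc i)) (rs zero)) * D)
      ≈⟨ *-congˡ (*-congʳ (∏K.∑-distrib-+ (λ i → W (suc i)) λ i → differences (rs (suc i)) (rs zero))) ⟩
    W zero * ((∏ (λ i → W (suc i)) * ∏ (λ i → differences (rs (suc i)) (rs zero))) * D)
      ≈⟨ *-congˡ (*-assoc _ _ D) ⟩
    W zero * (∏ (λ i → W (suc i)) * (∏ (λ i → differences (rs (suc i)) (rs zero)) * D))
      ≈⟨ *-assoc _ _ _ ⟨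
    ∏ W * (∏ (λ i → differences (rs (suc i)) (rs zero)) * D)
      ≈⟨ *-congˡ (∏-i<j-suc λ i j → differences (rs j) (rs i)) ⟨
    ∏ W * ∏-i<j (λ i j → differences (rs j) (rs i)) ∎
    where
    f : Poly
    f = ∏X- (rs zero)
    W : Vector Carrier (suc n)
    W i = ∏ λ k → eval w (rs i k)
    D : Carrier
    D = ∏-i<j λ i j → differences (rs (suc j)) (rs (suc i))

  value-1 : ∀ {n} {ds : Vector ℕ n} (rs : ∀ i → Vector Carrier (ds i)) →
    value rs 1ₚ ≈ ∏-i<j (λ i j → differences (rs j) (rs i))
  value-1 {n} {ds} rs = trans (value-differences rs 1ₚ) (trans (*-congʳ (ones λ i → ones λ k → eval-1 (rs i k))) (*-identityˡ _))
    where
    ones : ∀ {n} {x : Vector Carrier n} → (∀ i → x i ≈ 1#) → ∏ x ≈ 1#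
    ones {n} e = trans (∏K.sum-cong-≋ e) (∏K.sum-replicate-zero n)

  -- The number of roots found by splitting equals the degree only propositionally; this lemma and
  -- the next remove the resulting transports.
  ∏X-subst : ∀ {m n} (e : m ≡ n) (r : Vector Carrier m) → ∏X- (subst (Vector Carrier) e r) ≡ ∏X- r
  ∏X-subst ≡.refl r = ≡.refl

  differences-subst : ∀ {m m′ n n′} (e : m ≡ m′) (e′ : n ≡ n′) r s →
    differences (subst (Vector Carrier) e r) (subst (Vector Carrier) e′ s) ≡ differences r s
  differences-subst ≡.refl ≡.refl r s = ≡.refl

-- Base change of determinants, polynomials and residues along a ring homomorphism.

module Homomorphisms {R : CommutativeRing c ℓ} {K : CommutativeRing c₁ ℓ₁}
    (φ : CommutativeRing.Carrier R → CommutativeRing.Carrier K)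
    (φ-hom : IsRingHomomorphism (CommutativeRing.rawRing R) (CommutativeRing.rawRing K) φ) where
  private
    module R where
      open CommutativeRing R public
      open FiniteSums R public
      open LinearAlgebra R public
      open Exp semiring public using (_^_)
    module R[X] where
      open Polynomials R public
      open Quotients R public
    module φ = IsRingHomomorphism φ-hom
  open CommutativeRing K hiding (zero)
  open FiniteSums K
  open LinearAlgebra K
  open Polynomials K
  open Quotients K
  open Exp semiring using (_^_)
  open Blocks K using (∏X-; Residues; Residues-cong; tabulate-cong)
  private
    module P = CommutativeRing R[X]
    module ∑K = MonoidSum +-commutativeMonoid

  φ-∑ : ∀ {n} (x : Vector R.Carrier n) → φ (R.∑ x) ≈ ∑ (λ i → φ (x i))
  φ-∑ {zero}  x = φ.0#-homo
  φ-∑ {suc n} x = trans (φ.+-homo _ _) (+-congˡ (φ-∑ (x ∘ suc)))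

  φ-sign : ∀ k → φ ((R.- R.1#) R.^ k) ≈ (- 1#) ^ k
  φ-sign zero    = φ.1#-homo
  φ-sign (suc k) = trans (φ.*-homo _ _) (*-cong (trans (φ.-‿homo _) (-‿cong φ.1#-homo)) (φ-sign k))

  φ-det : ∀ {n} (A : R.Matrix n n) → φ (R.det A) ≈ det (λ i j → φ (A i j))
  φ-det {zero}  A = φ.1#-homo
  φ-det {suc n} A = trans (φ-∑ λ j → (R.- R.1#) R.^ toℕ j R.* (A zero j R.* minor j)) (∑K.sum-cong-≋ λ j →
    trans (φ.*-homo ((R.- R.1#) R.^ toℕ j) (A zero j R.* minor j)) (*-cong (φ-sign (toℕ j))
      (trans (φ.*-homo (A zero j) (minor j)) (*-congˡ {φ (A zero j)} (φ-det λ i k → A (suc i) (punchIn j k))))))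
    where
    minor : Vector R.Carrier (suc n)
    minor j = R.det λ i k → A (suc i) (punchIn j k)

  mapₚ : R[X].Poly → Poly
  mapₚ = List.map φ

  coeff-mapₚ : ∀ p k → coeff (mapₚ p) k ≈ φ (R[X].coeff p k)
  coeff-mapₚ []      k       = sym φ.0#-homo
  coeff-mapₚ (a ∷ p) zero    = refl
  coeff-mapₚ (a ∷ p) (suc k) = coeff-mapₚ p k

  mapₚ-cong : ∀ {p q} → p R[X].≈ₚ q → mapₚ p ≈ₚ mapₚ q
  mapₚ-cong {p} {q} e .at k = trans (coeff-mapₚ p k) (trans (φ.⟦⟧-cong (R[X].at e k)) (sym (coeff-mapₚ q k)))

  mapₚ-+ : ∀ p q → mapₚ (p R[X].+ₚ q) ≈ₚ mapₚ p +ₚ mapₚ q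
  mapₚ-+ []      q       = P.refl
  mapₚ-+ (a ∷ p) []      = P.refl
  mapₚ-+ (a ∷ p) (b ∷ q) = ∷-cong (φ.+-homo a b) (mapₚ-+ p q)

  mapₚ-neg : ∀ p → mapₚ (R[X].-ₚ p) ≈ₚ -ₚ mapₚ p
  mapₚ-neg []      = P.refl
  mapₚ-neg (a ∷ p) = ∷-cong (φ.-‿homo a) (mapₚ-neg p)

  mapₚ-· : ∀ a p → mapₚ (a R[X].· p) ≈ₚ φ a · mapₚ p
  mapₚ-· a []      = P.refl
  mapₚ-· a (b ∷ p) = ∷-cong (φ.*-homo a b) (mapₚ-· a p)

  mapₚ-* : ∀ p q → mapₚ (p R[X].*ₚ q) ≈ₚ mapₚ p *ₚ mapₚ q
  mapₚ-* []      q = P.refl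
  mapₚ-* (a ∷ p) q = P.trans (mapₚ-+ (a R[X].· q) (R.0# ∷ (p R[X].*ₚ q)))
    (P.+-cong (mapₚ-· a q) (∷-cong φ.0#-homo (mapₚ-* p q)))

  mapₚ-X^ : ∀ k → mapₚ (R[X].X^ k) ≈ₚ X^ k
  mapₚ-X^ zero    = ∷-cong φ.1#-homo P.refl
  mapₚ-X^ (suc k) = ∷-cong φ.0#-homo (mapₚ-X^ k)

  mapₚ-tabulate : ∀ {n} (v : Vector R.Carrier n) → mapₚ (tabulate v) ≡ tabulate (λ k → φ (v k))
  mapₚ-tabulate {zero}  v = ≡.refl
  mapₚ-tabulate {suc n} v = ≡.cong (φ (v zero) ∷_) (mapₚ-tabulate (v ∘ suc))

  -- Allowing any `f′` equal to the mapped modulus lets the split form be used directly.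
  mapₚ-mod : ∀ {p q f f′} → mapₚ f ≈ₚ f′ → p R[X].≈ q [mod f ] → mapₚ p ≈ mapₚ q [mod f′ ]
  mapₚ-mod {p} {q} {f} {f′} f≈f′ (R[X].congruent (s , e)) = congruent (mapₚ s , (begin
    mapₚ s *ₚ f′                   ≈⟨ P.*-congˡ {mapₚ s} f≈f′ ⟨
    mapₚ s *ₚ mapₚ f               ≈⟨ mapₚ-* s f ⟨
    mapₚ (s R[X].*ₚ f)             ≈⟨ mapₚ-cong e ⟩
    mapₚ (p R[X].+ₚ R[X].-ₚ q)     ≈⟨ mapₚ-+ p (R[X].-ₚ q) ⟩
    mapₚ p +ₚ mapₚ (R[X].-ₚ q)     ≈⟨ P.+-congˡ {mapₚ p} (mapₚ-neg q) ⟩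
    mapₚ p P.- mapₚ q              ∎))
    where open SetoidReasoning P.setoid

  -- The coordinates in the concatenated basis are, block by block, the remainders of `p` modulo
  -- each factor; congruence to a remainder survives the map to `K`, where the factor splits.
  coord-residues : ∀ {n} (fs : Vector R[X].Poly n) (ms : ∀ i → R[X].Monic (fs i))
    (rs : ∀ i → Vector Carrier (R[X].Monic.degree (ms i))) → (∀ i → mapₚ (fs i) ≈ₚ ∏X- (rs i)) → ∀ p →
    Residues rs (mapₚ p) (λ k → φ (R.Basis.coord
      (R.⨁-basis (λ i → R[X].R[X]/ fs i) (λ i → R[X].Monic.degree (ms i)) (λ i → R[X].standardBasis (fs i) (ms i))) (λ i → p) k))
  coord-residues {zero}  fs ms rs e p = _
  coord-residues {suc n} fs ms rs e p = first , Residues-cong (λ i → rs (suc i)) P.refl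
    (λ k → φ.⟦⟧-cong (R.reflexive (≡.sym (A.coord-↑ʳ (λ i → p) k))))
    (coord-residues (fs ∘ suc) (λ i → ms (suc i)) (λ i → rs (suc i)) (λ i → e (suc i)) p)
    where
    module A = R.Append (λ i → R[X].R[X]/ fs i) (R[X].standardBasis (fs zero) (ms zero))
      (R.⨁-basis (λ i → R[X].R[X]/ fs (suc i)) (λ i → R[X].Monic.degree (ms (suc i))) (λ i → R[X].standardBasis (fs (suc i)) (ms (suc i))))
    open R[X].Division (fs zero) (ms zero) using (remainder; remainder-correct)
    first : mapₚ p ≈ tabulate (λ k → φ (A.coord (λ i → p) (k ↑ˡ _))) [mod ∏X- (rs zero) ]
    first = mod-trans (∏X- (rs zero)) (mapₚ-mod (e zero) (remainder-correct p))
      (mod-reflexive (∏X- (rs zero)) (P.trans (P.reflexive (mapₚ-tabulate (remainder p)))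
        (tabulate-cong λ k → φ.⟦⟧-cong (R.reflexive (≡.sym (A.coord-↑ˡ (λ i → p) k))))))

-- Matching numbers of roots with degrees, and transported bases.

module _ (K : CommutativeRing c ℓ) (K-field : IsField K) (K-closed : AlgebraicallyClosed K) where
  open Polynomials K
  open Splitting K K-field K-closed

  number-splitting : ∀ d g l z → Roots.number (splitting d g l z) ≡ d
  number-splitting zero    g l z = ≡.refl
  number-splitting (suc d) g l z = ≡.cong suc (number-splitting d _ _ _)

  number-roots : ∀ {g} (m : Monic g) → Roots.number (roots m) ≡ Monic.degree m
  number-roots {g} m = number-splitting _ g _ _

module _ (R : CommutativeRing c ℓ) where
  open Polynomials R
  open LinearAlgebra R
  open Quotients R

  vec-subst : ∀ f (m : Monic f) {n} (e : Monic.degree m ≡ n) j →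
    Basis.vec (subst (Basis (R[X]/ f)) e (standardBasis f m)) j ≡ X^ (toℕ j)
  vec-subst f m ≡.refl j = ≡.refl

-- The determinant of the natural map, computed in the algebraic closure.

theoremA3 : {c ℓ c₁ ℓ₁ c₂ ℓ₂ : Level}
  (R : CommutativeRing c ℓ) (R-domain : IsIntegralDomain R)
  (F : FractionField R c₁ ℓ₁) (K : AlgebraicClosure (FractionField.ring F) c₂ ℓ₂) →
  let open Polynomials R
      open LinearAlgebra R
      open Quotients R
      open Resultants F K
      open CommutativeRing (AlgebraicClosure.ring K) using (_≈_)
      open FiniteSums (AlgebraicClosure.ring K) using (∏-i<j)
  in
  (f : Poly) (f-monic : Monic f)
  (n : ℕ) (fs : Fin n → Poly) (fs-monic : ∀ i → Monic (fs i))
  (f≈∏fs : f ≈ₚ ∏ₚ fs) →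
  let deg≡  = degree-∏ (IsIntegralDomain.1≉0 R-domain) fs f≈∏fs f-monic fs-monic
      basis = subst (Basis (R[X]/ f)) deg≡ (standardBasis f f-monic)
      bases = ⨁-basis (λ i → R[X]/ fs i) (λ i → Monic.degree (fs-monic i)) (λ i → standardBasis (fs i) (fs-monic i))
  in
  ι (det (matrixOf basis bases (Ψ f fs f≈∏fs))) ≈ ∏-i<j (λ i j → resultant (fs-monic j) (fs-monic i))
theoremA3 R R-domain F K f f-monic n fs fs-monic f≈∏fs = begin
  ι (det A)                                              ≈⟨ φ-det A ⟩
  LK.det (λ i j → ι (A i j))                             ≈⟨ det-residues rs PK.1ₚ (λ i j → ι (A i j)) residues ⟩
  value rs PK.1ₚ                                         ≈⟨ value-1 rs ⟩
  -- The transports that gave the root vectors the length of the degrees disappear here, leaving the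
  -- resultants as defined.
  ∏-i<j (λ i j → differences (rs j) (rs i))              ≈⟨ ∏-i<j-cong (λ i j → K.reflexive (differences-subst (number≡ j) (number≡ i) (Roots.root (ρ j)) (Roots.root (ρ i)))) ⟩
  ∏-i<j (λ i j → resultant (fs-monic j) (fs-monic i))    ∎
  where
  module Kᶜ = AlgebraicClosure K
  module K = CommutativeRing Kᶜ.ring
  module PK = Polynomials Kᶜ.ring
  module LK = LinearAlgebra Kᶜ.ring
  module K[X] = CommutativeRing PK.R[X]
  open SetoidReasoning K.setoid
  open FiniteSums Kᶜ.ring using (∏-i<j)
  open Polynomials R
  open LinearAlgebra R
  open Quotients R
  open Resultants F K
  open Splitting Kᶜ.ring Kᶜ.isField Kᶜ.algebraicallyClosed using (roots)
  open Blocks Kᶜ.ring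
  open Differences Kᶜ.ring
  open Homomorphisms {R = R} {K = Kᶜ.ring} ι ι-isRingHomomorphism
  deg≡ : Monic.degree f-monic ≡ totalℕ (λ i → Monic.degree (fs-monic i))
  deg≡ = degree-∏ (IsIntegralDomain.1≉0 R-domain) fs f≈∏fs f-monic fs-monic
  basis = subst (Basis (R[X]/ f)) deg≡ (standardBasis f f-monic)
  bases = ⨁-basis (λ i → R[X]/ fs i) (λ i → Monic.degree (fs-monic i)) (λ i → standardBasis (fs i) (fs-monic i))
  A = matrixOf basis bases (Ψ f fs f≈∏fs)
  ρ : ∀ i → Roots Kᶜ.ring (mapₚ (fs i))
  ρ i = roots (monic-map (fs-monic i))
  number≡ : ∀ i → Roots.number (ρ i) ≡ Monic.degree (fs-monic i)
  number≡ i = number-roots Kᶜ.ring Kᶜ.isField Kᶜ.algebraicallyClosed (monic-map (fs-monic i))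
  rs : ∀ i → Vector K.Carrier (Monic.degree (fs-monic i))
  rs i = subst (Vector K.Carrier) (number≡ i) (Roots.root (ρ i))
  split : ∀ i → mapₚ (fs i) PK.≈ₚ ∏X- (rs i)
  split i = K[X].trans (Roots.factorisation (ρ i)) (K[X].reflexive (≡.sym (∏X-subst (number≡ i) (Roots.root (ρ i)))))
  -- Column j represents the image of Xʲ, so the starting weight is 1.
  residues : ∀ j → Residues rs (PK.1ₚ PK.*ₚ PK.X^ (toℕ j)) (λ i → ι (A i j))
  residues j = Residues-cong rs
    (K[X].trans (K[X].reflexive (≡.cong mapₚ (vec-subst R f f-monic deg≡ j)))
      (K[X].trans (mapₚ-X^ (toℕ j)) (K[X].sym (K[X].*-identityˡ (PK.X^ (toℕ j))))))
    (λ k → K.refl)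
    -- `Ψ` is the identity on representatives, so its value at a basis vector is the constant family
    -- at that polynomial.
    (coord-residues fs fs-monic rs split (Basis.vec basis j))
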